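{- Let $p\geq 1$ be a fixed constant. The decision problem $\langle I,T,\mathrm{sup},k,s\rangle$, restricted to inputs in which $I$ is a finite set of boolean attributes, $T$ is a database on $I$, $1\le k\le|I|$ is a natural, and $0<s\le 1$ is a rational with $\lceil s|T|\rceil=p$, is in $TC^0$.
   Context: An attribute $A$ (categorical or numeric) has a domain $\mathrm{dom}(A)$ containing a special null value $\epsilon$; $A$ is boolean if $\mathrm{dom}(A)=\{\epsilon,c(A)\}$ for a constant $c(A)$. A database $T$ on a finite attribute set $I$ is a relation with duplicates (a finite multiset of tuples) having attribute set $I$; $t[A]$ is the value of $A$ in tuple $t$. An atomic condition on a categorical attribute $A$ is $A=u$ or $A\neq u$ with $u\in \mathrm{dom}(A)\setminus\{\epsilon\}$; on a numeric attribute $A$ it is $A\in[l,u]$ or $A\notin[l,u]$ with numeric values $l\le u$. A tuple $t$ satisfies an atomic condition on $A$ iff $t[A]\neq\epsilon$ and $t[A]$ fulfils the stated relation (so a null value satisfies no condition). A condition is a conjunction $C=C_1\wedge\dots\wedge C_n$ of atomic conditions on distinct attributes; its size is $|C|=n$; $t$ satisfies $C$ iff it satisfies every $C_i$; $T_C$ is the (multi)set of tuples of $T$ satisfying $C$, with $|T_C|$ counted with duplicates. An association rule on $I$ is $B\Rightarrow H$ with $B,H$ conditions on attribute sets $I_B,I_H$ with $\emptyset\subset I_B,I_H\subset I$ and $I_B\cap I_H=\emptyset$; its size is $|B\Rightarrow H|=|B|+|H|$. It is trivial (w.r.t. $T$) if $B\wedge H$ contains at least one atomic condition $C_a$ with $T_{C_a}=T$.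 The support is $\mathrm{sup}(B\Rightarrow H,T)=|T_{B\wedge H}|/|T|$. The problem $\langle I,T,\rho,k,s\rangle$ for an index $\rho$ asks: is there a non-trivial association rule $R$ on $I$ with $|R|\ge k$ and $\rho(R,T)\ge s$? A boolean database $T=\{t_1,\dots,t_m\}$ on $I=\{A_1,\dots,A_n\}$ is presented to a circuit as the $m\times n$ boolean matrix $(x_{i,j})$ with $x_{i,j}=1$ if $t_i[A_j]=c(A_j)$ and $x_{i,j}=0$ if $t_i[A_j]=\epsilon$. A MAJORITY gate is an unbounded fan-in gate outputting 1 iff more than half of its inputs are non-zero. $TC^0$ is the class of decision problems solved by (logspace-)uniform families of circuits of polynomial size and constant depth with MAJORITY and NOT gates of unbounded fan-in. -}

module Defs where

open import Level using (Level; _⊔_) renaming (suc to lsuc)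
open import Data.Bool using (Bool; true; false; not)
import Data.Bool as Bool
open import Data.Nat as ℕ using (ℕ; zero; suc; _+_; _*_; _^_; _≤_)
open import Data.Nat.Logarithm using (⌈log₂_⌉)
open import Data.Integer as ℤ using (+_; ∣_∣)
open import Data.Rational as ℚ using (ℚ; 0ℚ; 1ℚ; ↥_; ↧ₙ_)
import Data.Rational.Properties as ℚ
open import Data.Digit using (toDigits)
open import Data.Fin using (Fin; toℕ)
open import Data.Maybe using (Maybe; just; nothing; is-just)
import Data.Maybe.Relation.Unary.Any as Maybe
open import Data.List as List
  using (List; []; _∷_; [_]; _++_; length; map; filter; foldr; concatMap;
         replicate; tabulate; fromMaybe)
open import Data.List.Relation.Unary.All using (All; all?)
open import Data.List.Relation.Unary.Any using (Any)
open import Data.List.Relation.Unary.Unique.Propositional using (Unique)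
open import Data.List.Relation.Binary.Disjoint.Propositional using (Disjoint)
open import Data.Vec as Vec using (Vec; _∷ʳ_; lookup)
open import Data.Unit using (⊤)
open import Data.Product using (Σ; ∃-syntax; _×_; _,_; proj₁; proj₂)
open import Function using (_⇔_; _↔_; Injective)
open import Relation.Nullary using (does; ¬_; ¬?; _×-dec_)
open import Relation.Unary using (Decidable)
open import Relation.Binary using (DecidableEquality)
open import Relation.Binary.PropositionalEquality using (_≡_; _≢_)

private variable
  a ℓ : Level
  n : ℕ

-- `V` is the set of non-null values; the null value ε is `nothing` in `dom`.
data Attribute : Set₁ where
  categorical : (V : Set) → DecidableEquality V → Attribute
  numeric     : (V : Set) (value : V → ℚ) → Injective _≡_ _≡_ value → Attribute

Value : Attribute → Set
Value (categorical V _) = V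
Value (numeric V _ _)   = V

dom : Attribute → Set
dom A = Maybe (Value A)

Boolean : Attribute → Set
Boolean A = ∃[ c ] (∀ (v : Value A) → v ≡ c)

AttributeSet : ℕ → Set₁
AttributeSet n = Fin n → Attribute

Tuple : AttributeSet n → Set
Tuple {n} I = (j : Fin n) → dom (I j)

-- A multiset of tuples, listed in some order with repetitions.
Database : AttributeSet n → Set
Database I = List (Tuple I)

data CategoricalRelation (V : Set) : Set where
  equal unequal : V → CategoricalRelation V

data NumericRelation : Set where
  inside outside : (l u : ℚ) → l ℚ.≤ u → NumericRelation

Relation : Attribute → Set
Relation (categorical V _) = CategoricalRelation V
Relation (numeric _ _ _)   = NumericRelation

Fulfils : (A : Attribute) → Relation A → Value A → Set
Fulfils (categorical _ _)   (equal u)       v = v ≡ u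
Fulfils (categorical _ _)   (unequal u)     v = v ≢ u
Fulfils (numeric _ value _) (inside l u _)  v = l ℚ.≤ value v × value v ℚ.≤ u
Fulfils (numeric _ value _) (outside l u _) v = ¬ (l ℚ.≤ value v × value v ℚ.≤ u)

fulfils? : (A : Attribute) (r : Relation A) → Decidable (Fulfils A r)
fulfils? (categorical _ _≟_) (equal u)       v = v ≟ u
fulfils? (categorical _ _≟_) (unequal u)     v = ¬? (v ≟ u)
fulfils? (numeric _ value _) (inside l u _)  v = (l ℚ.≤? value v) ×-dec (value v ℚ.≤? u)
fulfils? (numeric _ value _) (outside l u _) v = ¬? ((l ℚ.≤? value v) ×-dec (value v ℚ.≤? u))

AtomicCondition : AttributeSet n → Set
AtomicCondition {n} I = Σ (Fin n) (λ j → Relation (I j))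

-- `Maybe.Any` fails on `nothing`: a null value satisfies no condition.
SatisfiesAtom : {I : AttributeSet n} → AtomicCondition I → Tuple I → Set
SatisfiesAtom {I = I} (j , r) t = Maybe.Any (Fulfils (I j) r) (t j)

satisfiesAtom? : {I : AttributeSet n} (C : AtomicCondition I) → Decidable (SatisfiesAtom C)
satisfiesAtom? {I = I} (j , r) t = Maybe.dec (fulfils? (I j) r) (t j)

Satisfies : {I : AttributeSet n} → List (AtomicCondition I) → Tuple I → Set
Satisfies Cs t = All (λ C → SatisfiesAtom C t) Cs

satisfies? : {I : AttributeSet n} (Cs : List (AtomicCondition I)) → Decidable (Satisfies Cs)
satisfies? Cs t = all? (λ C → satisfiesAtom? C t) Cs

-- T_C
select : {I : AttributeSet n} → List (AtomicCondition I) → Database I → Database I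
select Cs T = filter (satisfies? Cs) T

attributesOf : {I : AttributeSet n} → List (AtomicCondition I) → List (Fin n)
attributesOf = map proj₁

record Condition (I : AttributeSet n) : Set where
  field
    conjuncts : List (AtomicCondition I)
    distinct  : Unique (attributesOf conjuncts)

  attributes : List (Fin n)
  attributes = attributesOf conjuncts

  size : ℕ
  size = length conjuncts

-- I_B and I_H are automatically proper subsets of I, being disjoint and nonempty.
record Rule (I : AttributeSet n) : Set where
  field
    body head     : Condition I
    body-nonempty : Condition.attributes body ≢ []
    head-nonempty : Condition.attributes head ≢ []
    disjoint      : Disjoint (Condition.attributes body) (Condition.attributes head)

  body∧head : List (AtomicCondition I)
  body∧head = Condition.conjuncts body ++ Condition.conjuncts head

  size : ℕ
  size = Condition.size body + Condition.size head

Trivial : {I : AttributeSet n} → Rule I → Database I → Set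
Trivial R T = Any (λ C → select [ C ] T ≡ T) (Rule.body∧head R)

Index : Set₁
Index = ∀ {n} {I : AttributeSet n} → Rule I → Database I → ℚ

-- Division by zero, which arises only for the empty database, is set to 0.
ratio : ℕ → ℕ → ℚ
ratio a zero    = 0ℚ
ratio a (suc b) = + a ℚ./ suc b

sup : Index
sup R T = ratio (length (select (Rule.body∧head R) T)) (length T)

record Instance : Set₁ where
  field
    #attributes : ℕ
    I           : AttributeSet #attributes
    T           : Database I
    k           : ℕ
    s           : ℚ

Solvable : Index → Instance → Set
Solvable ρ x = ∃[ R ] (¬ Trivial {I = I} R T × k ≤ Rule.size R × s ℚ.≤ ρ R T)
  where open Instance x

record BooleanInstance (p : ℕ) : Set₁ where
  field
    inst : Instance
  open Instance inst public
  field
    boolean   : ∀ j → Boolean (I j)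
    1≤k       : 1 ≤ k
    k≤∣I∣     : k ≤ #attributes
    0<s       : 0ℚ ℚ.< s
    s≤1       : s ℚ.≤ 1ℚ
    threshold : ℚ.⌈ s ℚ.* (+ length T ℚ./ 1) ⌉ ≡ + p

unary : ℕ → List Bool
unary m = replicate m true ++ [ false ]

-- Self-delimiting: each binary digit d becomes 1 d, and a final 0 is appended.
binary : ℕ → List Bool
binary m = concatMap (λ d → true ∷ bit d ∷ []) (proj₁ (toDigits 2 m)) ++ [ false ]
  where
  bit : Fin 2 → Bool
  bit Fin.zero    = false
  bit (Fin.suc _) = true

-- On boolean attributes the entry for t[A] is 1 if t[A] = c(A) and 0 if t[A] = ε.
row : (I : AttributeSet n) → Tuple I → List Bool
row I t = tabulate (λ j → is-just (t j))

-- 1^m 0 1^n 0 1^k 0, the m × n matrix in row-major order, and the fraction s in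
-- binary.  Since k ≤ n, writing k in unary does not inflate the input.
encode : ∀ {p} → BooleanInstance p → List Bool
encode x =
  unary (length T) ++ unary #attributes ++ unary k ++
  concatMap (row I) T ++
  binary ∣ ↥ s ∣ ++ binary (↧ₙ s)
  where open BooleanInstance x

-- A MAJORITY gate without inputs outputs 0.  A wire listed several times counts with
-- multiplicity, both as an input of a MAJORITY gate and in the size of the circuit.
data Gate (Wire : Set) : Set where
  MAJ : List Wire → Gate Wire
  NOT : Wire → Gate Wire

-- `Circuit N w` has N inputs and w wires in total: wires 0, …, N-1 are the inputs
-- and each further gate output takes the next free number.
data Circuit (N : ℕ) : ℕ → Set where
  inputs : Circuit N N
  _▷_    : ∀ {w} → Circuit N w → Gate (Fin w) → Circuit N (suc w)

majority : List Bool → Bool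
majority bs = does (length bs ℕ.<? 2 * length (filter (Bool._≟ true) bs))

evalGate : ∀ {w} → Vec Bool w → Gate (Fin w) → Bool
evalGate vs (MAJ ws) = majority (map (lookup vs) ws)
evalGate vs (NOT i)  = not (lookup vs i)

evalWires : ∀ {N w} → Circuit N w → Vec Bool N → Vec Bool w
evalWires inputs  xs = xs
evalWires (C ▷ g) xs = evalWires C xs ∷ʳ evalGate (evalWires C xs) g

eval : ∀ {N w} → Circuit N (suc w) → Vec Bool N → Bool
eval C xs = Vec.last (evalWires C xs)

gateDepth : ∀ {w} → Vec ℕ w → Gate (Fin w) → ℕ
gateDepth ds (MAJ ws) = suc (foldr ℕ._⊔_ 0 (map (lookup ds) ws))
gateDepth ds (NOT i)  = suc (lookup ds i)

wireDepths : ∀ {N w} → Circuit N w → Vec ℕ w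
wireDepths inputs  = Vec.replicate _ 0
wireDepths (C ▷ g) = wireDepths C ∷ʳ gateDepth (wireDepths C) g

depth : ∀ {N w} → Circuit N w → ℕ
depth C = Vec.foldr _ ℕ._⊔_ 0 (wireDepths C)

fanIn : ∀ {Wire} → Gate Wire → ℕ
fanIn (MAJ ws) = length ws
fanIn (NOT _)  = 1

-- Number of gates plus number of connections.
circuitSize : ∀ {N w} → Circuit N w → ℕ
circuitSize inputs  = 0
circuitSize (C ▷ g) = circuitSize C + suc (fanIn g)

data Symbol : Set where
  maj neg one end : Symbol

-- Wire number i is written as i copies of `one` followed by `end`.
describeWire : ∀ {w} → Fin w → List Symbol
describeWire i = replicate (toℕ i) one ++ [ end ]

describeGate : ∀ {w} → Gate (Fin w) → List Symbol
describeGate (MAJ ws) = maj ∷ concatMap describeWire ws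
describeGate (NOT i)  = neg ∷ describeWire i

describe : ∀ {N w} → Circuit N w → List Symbol
describe inputs  = []
describe (C ▷ g) = describe C ++ describeGate g

Finite : Set → Set
Finite A = ∃[ m ] (A ↔ Fin m)

data Move : Set where
  left stay right : Move

-- Work tapes are infinite in both directions.  Only the visited cells are stored;
-- both lists start with the cell next to the head.
record Tape (Γ : Set) : Set where
  constructor tape
  field
    leftOf  : List Γ
    scanned : Γ
    rightOf : List Γ

  visited : ℕ
  visited = suc (length leftOf + length rightOf)

moveTape : {Γ : Set} → Γ → Move → Tape Γ → Tape Γ
moveTape blank left  (tape []       x rs)       = tape [] blank (x ∷ rs)
moveTape blank left  (tape (l ∷ ls) x rs)       = tape ls l (x ∷ rs)
moveTape blank stay  t                          = t
moveTape blank right (tape ls       x [])       = tape (x ∷ ls) blank []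
moveTape blank right (tape ls       x (r ∷ rs)) = tape (x ∷ ls) r rs

writeTape : {Γ : Set} → Γ → Tape Γ → Tape Γ
writeTape y (tape ls _ rs) = tape ls y rs

-- The input w occupies cells 1, …, |w| of a read-only tape, between two end markers.
data InputCell (A : Set) : Set where
  ⊢ ⊣ : InputCell A
  sym : A → InputCell A

readInput : {A : Set} → List A → ℕ → InputCell A
readInput w       zero          = ⊢
readInput []      (suc _)       = ⊣
readInput (x ∷ _) (suc zero)    = sym x
readInput (_ ∷ w) (suc (suc i)) = readInput w (suc i)

moveInput : {A : Set} → List A → Move → ℕ → ℕ
moveInput w left  i = ℕ.pred i
moveInput w stay  i = i
moveInput w right i = suc i ℕ.⊓ suc (length w)

record Action (State Γ : Set) (#tapes : ℕ) (B : Set) : Set where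
  constructor action
  field
    next      : State
    inputMove : Move
    work      : Vec (Γ × Move) #tapes
    emit      : Maybe B

record Config (State Γ : Set) (#tapes : ℕ) : Set where
  constructor config
  field
    state     : State
    inputHead : ℕ
    tapes     : Vec (Tape Γ) #tapes

record Transducer (A B : Set) : Set₁ where
  field
    State       : Set
    stateFinite : Finite State
    Γ           : Set
    Γ-finite    : Finite Γ
    blank       : Γ
    #tapes      : ℕ
    start       : State
    -- `nothing` means that the machine halts.
    δ           : State → InputCell A → Vec Γ #tapes → Maybe (Action State Γ #tapes B)

  initial : Config State Γ #tapes
  initial = config start 1 (Vec.replicate #tapes (tape [] blank []))

  current : List A → Config State Γ #tapes → Maybe (Action State Γ #tapes B)
  current w (config q i ts) = δ q (readInput w i) (Vec.map Tape.scanned ts)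

  perform : List A → Action State Γ #tapes B → Config State Γ #tapes → Config State Γ #tapes
  perform w (action q d work _) (config _ i ts) =
    config q (moveInput w d i)
      (Vec.zipWith (λ (y , m) t → moveTape blank m (writeTape y t)) work ts)

  -- The cells visited so far on each work tape number at most S.
  WithinSpace : ℕ → Config State Γ #tapes → Set
  WithinSpace S c = ∀ i → Tape.visited (lookup (Config.tapes c) i) ≤ S

  -- `Run S w c out`: on input w, from c, the machine halts after emitting `out`,
  -- using space at most S throughout.
  data Run (S : ℕ) (w : List A) (c : Config State Γ #tapes) : List B → Set where
    halt : WithinSpace S c → current w c ≡ nothing → Run S w c []
    step : ∀ {α out} → WithinSpace S c → current w c ≡ just α →
           Run S w (perform w α c) out →
           Run S w c (fromMaybe (Action.emit α) ++ out)

LogspaceComputes : {A B : Set} → Transducer A B → (List A → List B) → Set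
LogspaceComputes M f =
  ∃[ c ] (∀ w → Run (c * suc ⌈log₂ length w ⌉) w initial (f w))
  where open Transducer M

record CircuitFamily : Set where
  field
    width   : ℕ → ℕ
    circuit : ∀ N → Circuit N (suc (width N))

  accepts : List Bool → Bool
  accepts w = eval (circuit (length w)) (Vec.fromList w)

  ConstantDepth : Set
  ConstantDepth = ∃[ d ] (∀ N → depth (circuit N) ≤ d)

  PolynomialSize : Set
  PolynomialSize = ∃[ c ] ∃[ e ] (∀ N → circuitSize (circuit N) ≤ c * N ^ e + c)

  -- The description of the N-th circuit is computed in logarithmic space from 1^N,
  -- the word of length N over the one-letter alphabet ⊤.
  LogspaceUniform : Set₁
  LogspaceUniform =
    Σ (Transducer ⊤ Symbol) λ M →
      LogspaceComputes M (λ w → describe (circuit (length w)))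

-- The problem "does Q hold of x?", where x is presented as the bit string `enc x`.
-- Bit strings that encode no x are unconstrained.
InTC⁰ : {X : Set a} → (X → List Bool) → (X → Set ℓ) → Set (a ⊔ ℓ ⊔ lsuc Level.zero)
InTC⁰ {X = X} enc Q = Σ CircuitFamily λ F → let open CircuitFamily F in
  ConstantDepth × PolynomialSize × LogspaceUniform ×
  (∀ (x : X) → Q x ⇔ accepts (enc x) ≡ true)

{-# OPTIONS --safe #-}

-- A rule reaches the threshold iff p distinct rows share 1s in at least max(k, 2)
-- columns that are not constantly 1: on a Boolean attribute the only condition that a
-- tuple can satisfy is "not null", and sup R ≥ s means that at least ⌈ s |T| ⌉ = p rows
-- satisfy R.  For fixed p this is expressed by a first-order formula with threshold
-- quantifiers over the positions of the input, the prefix 1^m 0 1^n 0 1^k 0 being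
-- recognised by guessing m, n and k.
--
-- Every such formula has uniform TC⁰ circuits: a threshold quantifier becomes a MAJORITY
-- gate padded with constants.  The sub-circuit of a subformula for given values of its
-- variables starts at a wire whose number is a polynomial in these values and in the
-- input length.  As wires are described in unary, the description of the circuit is
-- printed by a program made of nested counting loops only, and such a program runs in
-- logarithmic space with its loop counters kept as binary tracks of one work tape.
module Submission where

open import Defs hiding (sym)
open import Data.Bool as Bool using (Bool; true; false; not; _∧_; _xor_; if_then_else_)
import Data.Bool.Properties as Bool
open import Data.Empty using (⊥-elim)
open import Data.Fin as Fin using (Fin; zero; suc; toℕ)
import Data.Fin.Properties as Fin
open import Data.Integer as ℤ using () renaming (+_ to pos)
import Data.Integer.DivMod as ℤ
import Data.Integer.Properties as ℤ
open import Data.Integer.Tactic.RingSolver using () renaming (solve-∀ to solveℤ-∀)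
open import Data.List as List
  using (List; []; _∷_; [_]; _++_; _ʳ++_; length; map; replicate; reverse; fromMaybe;
         concatMap; filter; foldr; tabulate; allFin)
import Data.List.Properties as List
open import Data.List.Membership.Propositional using (_∈_; find; lose)
open import Data.List.Membership.Propositional.Properties
  using (∈-filter⁺; ∈-filter⁻; ∈-allFin; ∈-map⁻; ∈-lookup)
open import Data.List.Relation.Binary.Pointwise as Pointwise using (Pointwise; []; _∷_)
open import Data.List.Relation.Unary.All as All using (All; []; _∷_)
import Data.List.Relation.Unary.All.Properties as All
open import Data.List.Relation.Unary.AllPairs using ([]; _∷_)
open import Data.List.Relation.Unary.Any as Any using (here; there)
import Data.List.Relation.Unary.Any.Properties as Any
open import Data.List.Relation.Unary.Unique.Propositional using (Unique)
import Data.List.Relation.Unary.Unique.Propositional.Properties as Unique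
open import Data.Maybe using (Maybe; just; nothing; is-just)
import Data.Maybe.Relation.Unary.Any as Maybe
open import Data.Nat as ℕ
  using (ℕ; zero; suc; _+_; _*_; _^_; _≤_; _<_; _⊔_; z≤n; s≤s; ⌊_/2⌋)
open import Data.Nat.Logarithm using (⌈log₂_⌉; ⌈log₂⌉-mono-≤; ⌈log₂2^n⌉≡n)
import Data.Nat.Properties as ℕ
open import Data.Nat.Tactic.RingSolver using (solve-∀)
open import Data.Product using (∃-syntax; _×_; _,_; proj₁; proj₂)
open import Data.Product.Function.NonDependent.Propositional using (_×-↔_)
open import Data.Rational as ℚ using (↥_; ↧_; ↧ₙ_; toℚᵘ)
import Data.Rational.Properties as ℚ
open import Data.Rational.Unnormalised as ℚᵘ using (mkℚᵘ; *≡*; *≤*)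
import Data.Rational.Unnormalised.Properties as ℚᵘ
open import Data.Sum using (_⊎_; inj₁; inj₂)
open import Data.Sum.Function.Propositional using (_⊎-↔_)
open import Data.Unit using (⊤; tt)
open import Data.Vec as Vec using (Vec; []; _∷_; lookup; _∷ʳ_)
import Data.Vec.Properties as Vec
open import Data.Vec.Relation.Unary.All as VecAll using ([]; _∷_)
import Data.Vec.Relation.Unary.All.Properties as VecAll
open import Function using (_↔_; _⇔_; mk↔ₛ′; mk⇔; Equivalence; _∘_; id; case_of_)
open import Function.Construct.Composition using (_↔-∘_)
open import Function.Construct.Symmetry using (↔-sym)
open import Relation.Binary.Definitions using (tri<; tri≈; tri>)
open import Relation.Binary.PropositionalEquality
  using (_≡_; refl; sym; trans; cong; cong₂; subst; subst₂; module ≡-Reasoning)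
open import Relation.Nullary using (Dec; yes; no; does; ¬_)
open import Relation.Nullary.Decidable using (does-⇔; dec-true; dec-false)
open import Relation.Unary using (Decidable)

-- Finite sets

-- A circuit is fixed by the input length N, but N does not determine m, n and k, so no wire can be
-- addressed by row and column beforehand. Quantifying m, n and k over all values below N removes
-- this obstacle: on an encoded instance exactly one triple passes the check of the prefix. Guesses
-- that are wrong may ask for bits beyond the word, hence the zero wires after the inputs.
--
-- For wire numbers to stay polynomial, the block of a quantifier holds one copy of its subformula
-- for each value below N, whatever the bound of the quantifier; only the root gate restricts itself
-- to the copies below that bound.
--
-- The 2 in max(k, 2) comes from body and head both being nonempty. Rows are picked in descending
-- order, which makes them distinct without any test.
--
-- Gates are never counted: each gate and each connection costs at least one symbol of the
-- description, so the output length of the printing program bounds the size. Evaluation is a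
-- relation carrying depth next to value; a single induction then yields correctness, the depth
-- bound and the validity of all wire numbers.

finite-⊤ : Finite ⊤
finite-⊤ = 1 , ↔-sym Fin.1↔⊤

finite-Bool : Finite Bool
finite-Bool = 2 , ↔-sym Fin.2↔Bool

finite-Fin : ∀ n → Finite (Fin n)
finite-Fin n = n , mk↔ₛ′ (λ i → i) (λ i → i) (λ _ → refl) (λ _ → refl)

finite-transport : {A B : Set} → A ↔ B → Finite A → Finite B
finite-transport A↔B (m , A↔m) = m , (A↔m ↔-∘ ↔-sym A↔B)

finite-⊎ : {A B : Set} → Finite A → Finite B → Finite (A ⊎ B)
finite-⊎ (m , A↔m) (n , B↔n) = m + n , (↔-sym Fin.+↔⊎ ↔-∘ (A↔m ⊎-↔ B↔n))

finite-× : {A B : Set} → Finite A → Finite B → Finite (A × B)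
finite-× (m , A↔m) (n , B↔n) = m * n , (↔-sym Fin.*↔× ↔-∘ (A↔m ×-↔ B↔n))

finite-Maybe : {A : Set} → Finite A → Finite (Maybe A)
finite-Maybe A-finite = finite-transport
  (mk↔ₛ′ (λ { (inj₁ _) → nothing ; (inj₂ x) → just x })
         (λ { nothing → inj₁ tt ; (just x) → inj₂ x })
         (λ { nothing → refl ; (just _) → refl })
         (λ { (inj₁ _) → refl ; (inj₂ _) → refl }))
  (finite-⊎ finite-⊤ A-finite)

finite-Vec : {A : Set} → Finite A → ∀ n → Finite (Vec A n)
finite-Vec A-finite zero = finite-transport
  (mk↔ₛ′ (λ _ → []) (λ _ → tt) (λ { [] → refl }) (λ _ → refl)) finite-⊤
finite-Vec A-finite (suc n) = finite-transport
  (mk↔ₛ′ {B = Vec _ (suc n)} (λ (x , xs) → x ∷ xs) (λ { (x ∷ xs) → x , xs })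
         (λ { (_ ∷ _) → refl }) (λ _ → refl))
  (finite-× A-finite (finite-Vec A-finite n))

-- Binary digits

bit : Bool → ℕ
bit b = if b then 1 else 0

odd : ℕ → Bool
odd zero    = false
odd (suc n) = not (odd n)

half-suc : ∀ n → ⌊ suc n /2⌋ ≡ bit (odd n) + ⌊ n /2⌋
half-suc zero          = refl
half-suc (suc zero)    = refl
half-suc (suc (suc n)) with odd n | half-suc n
... | true  | eq = cong suc eq
... | false | eq = cong suc eq

half-bit+ : ∀ c n → ⌊ bit c + n /2⌋ ≡ bit (c ∧ odd n) + ⌊ n /2⌋
half-bit+ false n = refl
half-bit+ true  n = half-suc n

odd-bit+ : ∀ c n → odd (bit c + n) ≡ c xor odd n
odd-bit+ false n = refl
odd-bit+ true  n = refl

half-< : ∀ n {k} → n < 2 * k → ⌊ n /2⌋ < k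
half-< n {zero} ()
half-< zero          {suc k} _   = s≤s z≤n
half-< (suc zero)    {suc k} _   = s≤s z≤n
half-< (suc (suc n)) {suc k} n<k = s≤s (half-< n (ℕ.≤-pred (ℕ.≤-pred
  (subst (3 + n ≤_) (cong suc (ℕ.+-suc k (k + 0))) n<k))))

half-2* : ∀ k → ⌊ 2 * k /2⌋ ≡ k
half-2* zero    = refl
half-2* (suc k) rewrite ℕ.+-suc k (k + 0) = cong suc (half-2* k)

half-<⊎≡ : ∀ {m n} → m < n →
  ⌊ m /2⌋ < ⌊ n /2⌋ ⊎ (⌊ m /2⌋ ≡ ⌊ n /2⌋ × odd m ≡ false × odd n ≡ true)
half-<⊎≡ {zero}        {suc zero}    _ = inj₂ (refl , refl , refl)
half-<⊎≡ {zero}        {suc (suc n)} _ = inj₁ (s≤s z≤n)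
half-<⊎≡ {suc zero}    {suc zero}    (s≤s ())
half-<⊎≡ {suc zero}    {suc (suc n)} _ = inj₁ (s≤s z≤n)
half-<⊎≡ {suc (suc m)} {suc zero}    (s≤s ())
half-<⊎≡ {suc (suc m)} {suc (suc n)} (s≤s (s≤s m<n)) with half-<⊎≡ {m} {n} m<n
... | inj₁ lt = inj₁ (s≤s lt)
... | inj₂ (eq , p , q) rewrite p | q = inj₂ (cong suc eq , refl , refl)

-- Composable fragments of a machine with one work tape.

module Machine (r : ℕ) where

  -- A column holds one binary digit of each of the counters.
  Column : Set
  Column = Vec Bool (suc r)

  Γ : Set
  Γ = Maybe Column

  -- A piece of a machine that leaves with a result in `E` instead of halting; tests have
  -- `E = Bool`. The last step already leaves, so no extra step is spent on the exit.
  record Fragment (E : Set) : Set₁ where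
    field
      State  : Set
      finite : Finite State
      start  : State
      step   : State → InputCell ⊤ → Γ → (State ⊎ E) × Move × (Γ × Move) × Maybe Symbol

  Memory : Set
  Memory = ℕ × Tape Γ

  module _ (w : List ⊤) (S : ℕ) where

    module _ {E : Set} (F : Fragment E) where
      open Fragment F

      response : State → Memory → (State ⊎ E) × Move × (Γ × Move) × Maybe Symbol
      response q (i , t) = step q (readInput w i) (Tape.scanned t)

      target : State → Memory → State ⊎ E
      target q m = proj₁ (response q m)

      update : State → Memory → Memory
      update q m@(i , t) =
        let (_ , d , (y , e) , _) = response q m
        in moveInput w d i , moveTape nothing e (writeTape y t)

      output : State → Memory → List Symbol
      output q m = fromMaybe (proj₂ (proj₂ (proj₂ (response q m))))

      -- Both ends lie in `State ⊎ E`, so that paths can be mapped along functions such as `enter`,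
      -- which identify the exit of one fragment with the start of the next.
      data Path : State ⊎ E → Memory → List Symbol → State ⊎ E → Memory → Set where
        stop : ∀ {q m} → Path q m [] q m
        go   : ∀ {q m out q′ m′} → Tape.visited (proj₂ m) ≤ S →
               Path (target q m) (update q m) out q′ m′ →
               Path (inj₁ q) m (output q m ++ out) q′ m′

      trans-Path : ∀ {q m o q′ m′ o′ q″ m″} →
        Path q m o q′ m′ → Path q′ m′ o′ q″ m″ → Path q m (o ++ o′) q″ m″
      trans-Path stop p = p
      trans-Path {o′ = o′} (go {q} {m} {out} v p) p′ =
        subst (λ o → Path _ _ o _ _) (sym (List.++-assoc (output q m) out o′))
              (go v (trans-Path p p′))

  idle : Fragment ⊤
  idle = record { State = ⊤ ; finite = finite-⊤ ; start = tt
                ; step = λ _ _ x → inj₂ tt , stay , (x , stay) , nothing }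

  write : Symbol → Fragment ⊤
  write b = record { State = ⊤ ; finite = finite-⊤ ; start = tt
                  ; step = λ _ _ x → inj₂ tt , stay , (x , stay) , just b }

  infixr 5 _then_
  _then_ : Fragment ⊤ → Fragment ⊤ → Fragment ⊤
  F then G = record
    { State  = F.State ⊎ G.State
    ; finite = finite-⊎ F.finite G.finite
    ; start  = inj₁ F.start
    ; step   = λ { (inj₁ q) a x → let (q′ , rest) = F.step q a x in enter q′ , rest
                 ; (inj₂ q) a x → let (q′ , rest) = G.step q a x in leave q′ , rest } }
    module then-states where
      module F = Fragment F
      module G = Fragment G
      enter : F.State ⊎ ⊤ → (F.State ⊎ G.State) ⊎ ⊤
      enter (inj₁ q) = inj₁ (inj₁ q)
      enter (inj₂ _) = inj₁ (inj₂ G.start)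
      leave : G.State ⊎ ⊤ → (F.State ⊎ G.State) ⊎ ⊤
      leave (inj₁ q) = inj₁ (inj₂ q)
      leave (inj₂ _) = inj₂ tt

  while_loop_ : Fragment Bool → Fragment ⊤ → Fragment ⊤
  while F loop G = record
    { State  = F.State ⊎ G.State
    ; finite = finite-⊎ F.finite G.finite
    ; start  = inj₁ F.start
    ; step   = λ { (inj₁ q) a x → let (q′ , rest) = F.step q a x in test q′ , rest
                 ; (inj₂ q) a x → let (q′ , rest) = G.step q a x in back q′ , rest } }
    module while-states where
      module F = Fragment F
      module G = Fragment G
      test : F.State ⊎ Bool → (F.State ⊎ G.State) ⊎ ⊤
      test (inj₁ q)     = inj₁ (inj₁ q)
      test (inj₂ true)  = inj₁ (inj₂ G.start)
      test (inj₂ false) = inj₂ tt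
      back : G.State ⊎ ⊤ → (F.State ⊎ G.State) ⊎ ⊤
      back (inj₁ q) = inj₁ (inj₂ q)
      back (inj₂ _) = inj₁ (inj₁ F.start)

  -- A pass over the tape by a letter-to-letter transducer, from left to right; at the
  -- right end a column may be appended.
  record Pass (E : Set) : Set₁ where
    field
      Q      : Set
      finite : Finite Q
      q₀     : Q
      f      : Q → Column → Q × Column
      append : Q → Maybe Column
      result : Q → E

    run : Q → List Column → Q × List Column
    run q []       = q , []
    run q (c ∷ cs) =
      let (q′ , c′) = f q c ; (q″ , cs′) = run q′ cs in q″ , c′ ∷ cs′

  pattern entering = zero
  pattern scanning = suc zero
  pattern turning  = suc (suc zero)
  pattern backing  = suc (suc (suc zero))

  -- A blank met while `backing` ends the sweep, so the right-hand blank reached after appending a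
  -- column has to be left in a state of its own, `turning`.
  sweep : {E : Set} → Pass E → Fragment E
  sweep {E} P = record
    { State  = Fin 4 × Q
    ; finite = finite-× (finite-Fin 4) finite
    ; start  = entering , q₀
    ; step   = λ s _ x → sweepStep s x }
    module sweep-states where
      open Pass P
      atEnd : Q → Maybe Column → ((Fin 4 × Q) ⊎ E) × (Γ × Move)
      atEnd q (just c) = inj₁ (turning , q) , (just c , right)
      atEnd q nothing  = inj₁ (backing , q) , (nothing , left)

      sweepStep : Fin 4 × Q → Γ → ((Fin 4 × Q) ⊎ E) × Move × (Γ × Move) × Maybe Symbol
      sweepStep (entering , q) x        = inj₁ (scanning , q) , stay , (x , right) , nothing
      sweepStep (scanning , q) (just c) =
        inj₁ (scanning , proj₁ (f q c)) , stay , (just (proj₂ (f q c)) , right) , nothing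
      sweepStep (scanning , q) nothing  =
        proj₁ (atEnd q (append q)) , stay , proj₂ (atEnd q (append q)) , nothing
      sweepStep (turning , q)  x        = inj₁ (backing , q) , stay , (x , left) , nothing
      sweepStep (backing , q)  (just c) = inj₁ (backing , q) , stay , (just c , left) , nothing
      sweepStep (backing , q)  nothing  = inj₂ (result q) , stay , (nothing , stay) , nothing

  -- The head is on the left end blank, and the right end blank is already stored. Every sweep
  -- restores exactly this shape, so that tapes can be compared by equality.
  rest : List Column → Tape Γ
  rest cs = tape [] nothing (map just cs ++ [ nothing ])

  module _ {w : List ⊤} {S : ℕ} where

    infix 4 _⊢_⇒[_]_,_
    _⊢_⇒[_]_,_ : {E : Set} (F : Fragment E) → Memory → List Symbol → E → Memory → Set
    F ⊢ m ⇒[ out ] e , m′ = Path w S F (inj₁ (Fragment.start F)) m out (inj₂ e) m′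

    from-≡ : ∀ {E} {F : Fragment E} {q i t t′ o q′ m} → t′ ≡ t →
      Path w S F q (i , t) o q′ m → Path w S F q (i , t′) o q′ m
    from-≡ refl p = p

    to-≡ : ∀ {E} {F : Fragment E} {q m o q′ i t t′} → t ≡ t′ →
      Path w S F q m o q′ (i , t) → Path w S F q m o q′ (i , t′)
    to-≡ refl p = p

    module _ (F G : Fragment ⊤) where
      open then-states F G

      then-first : ∀ {q m o q′ m′} → Path w S F q m o q′ m′ →
        Path w S (F then G) (enter q) m o (enter q′) m′
      then-first stop       = stop
      then-first (go v p) = go v (then-first p)

      then-second : ∀ {q m o q′ m′} → Path w S G q m o q′ m′ →
        Path w S (F then G) (leave q) m o (leave q′) m′
      then-second stop       = stop
      then-second (go v p) = go v (then-second p)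

      -- The two mapped paths meet definitionally: `enter (inj₂ tt)` and `leave (inj₁ G.start)` are
      -- the same state.
      then-⇒ : ∀ {m o m′ o′ m″} → F ⊢ m ⇒[ o ] tt , m′ → G ⊢ m′ ⇒[ o′ ] tt , m″ →
        (F then G) ⊢ m ⇒[ o ++ o′ ] tt , m″
      then-⇒ p p′ = trans-Path w S (F then G) (then-first p) (then-second p′)

    module _ (F : Fragment Bool) (G : Fragment ⊤) where
      open while-states F G

      while-test : ∀ {q m o q′ m′} → Path w S F q m o q′ m′ →
        Path w S (while F loop G) (test q) m o (test q′) m′
      while-test stop       = stop
      while-test (go v p) = go v (while-test p)

      while-body : ∀ {q m o q′ m′} → Path w S G q m o q′ m′ →
        Path w S (while F loop G) (back q) m o (back q′) m′
      while-body stop       = stop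
      while-body (go v p) = go v (while-body p)

      while-iterate : ∀ {m o m′ o′ m″} → F ⊢ m ⇒[ o ] true , m′ → G ⊢ m′ ⇒[ o′ ] tt , m″ →
        Path w S (while F loop G) (inj₁ (inj₁ F.start)) m (o ++ o′) (inj₁ (inj₁ F.start)) m″
      while-iterate p p′ = trans-Path w S (while F loop G) (while-test p) (while-body p′)

    module _ {E : Set} (P : Pass E) where
      open Pass P
      open sweep-states P

      scan : List Γ → List Column → Tape Γ
      scan ls []       = tape ls nothing []
      scan ls (c ∷ cs) = tape ls (just c) (map just cs ++ [ nothing ])

      scan-right : ∀ ls x cs →
        moveTape nothing right (tape ls x (map just cs ++ [ nothing ])) ≡ scan (x ∷ ls) cs
      scan-right ls x []      = refl
      scan-right ls x (_ ∷ _) = refl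

      visited-scan : ∀ ls cs → Tape.visited (scan ls cs) ≡ suc (length ls + length cs)
      visited-scan ls []       = refl
      visited-scan ls (c ∷ cs) = cong (λ k → suc (length ls + k))
        (trans (List.length-++ (map just cs))
        (trans (ℕ.+-comm _ 1) (cong suc (List.length-map just cs))))

      scan-path : ∀ {i} q ls cs → suc (length ls + length cs) ≤ S →
        Path w S (sweep P) (inj₁ (scanning , q)) (i , scan ls cs) []
             (inj₁ (scanning , proj₁ (run q cs)))
             (i , tape (map just (proj₂ (run q cs)) ʳ++ ls) nothing [])
      scan-path q ls []           v = stop
      scan-path {i} q ls (c ∷ cs) v = go
        (subst (_≤ S) (sym (visited-scan ls (c ∷ cs))) v)
        (from-≡ (scan-right ls (just c′) cs)
          (scan-path q′ (just c′ ∷ ls) cs (subst (_≤ S) (cong suc (ℕ.+-suc (length ls) (length cs))) v)))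
        where
        q′ = proj₁ (f q c)
        c′ = proj₂ (f q c)

      visited-left : ∀ (ls : List Column) x rs → Tape.visited
        (moveTape nothing left (tape (map just ls ++ [ nothing ]) x rs)) ≡ 2 + (length ls + length rs)
      visited-left []       x rs = refl
      visited-left (c ∷ ls) x rs = cong suc (trans
        (cong (_+ suc (length rs)) (trans (List.length-++ (map just ls))
           (trans (ℕ.+-comm _ 1) (cong suc (List.length-map just ls)))))
        (cong suc (ℕ.+-suc (length ls) (length rs))))

      -- Describing the tape as the result of a left move makes the claim uniform in `ls`: the cell
      -- reached is the nearest column or, when none remains, the left end blank.
      back-path : ∀ {i} q (ls : List Column) x rs → 2 + (length ls + length rs) ≤ S →
        Path w S (sweep P) (inj₁ (backing , q))
             (i , moveTape nothing left (tape (map just ls ++ [ nothing ]) x rs)) []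
             (inj₂ (result q)) (i , tape [] nothing (map just ls ʳ++ (x ∷ rs)))
      back-path q []       x rs v = go v stop
      back-path q (c ∷ ls) x rs v = go (subst (_≤ S) (sym (visited-left (c ∷ ls) x rs)) v)
        (back-path q ls (just c) (x ∷ rs)
          (subst (_≤ S) (cong (2 +_) (sym (ℕ.+-suc (length ls) (length rs)))) v))

      cells-reverse : ∀ (cs : List Column) →
        map just cs ʳ++ [ nothing ] ≡ map just (reverse cs) ++ [ nothing ]
      cells-reverse cs = trans (List.ʳ++-defn (map just cs))
        (cong (_++ [ nothing ]) (sym (List.reverse-map just cs)))

      reverse-cells : ∀ (cs : List Column) →
        map just (reverse cs) ʳ++ [ nothing ] ≡ map just cs ++ [ nothing ]
      reverse-cells cs = trans (cells-reverse (reverse cs))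
        (cong (λ xs → map just xs ++ [ nothing ]) (List.reverse-involutive cs))

      turn-path : ∀ {i} q cs → 2 + length cs ≤ S →
        Path w S (sweep P) (inj₁ (backing , q))
             (i , moveTape nothing left (tape (map just cs ʳ++ [ nothing ]) nothing [])) []
             (inj₂ (result q)) (i , rest cs)
      turn-path {i} q cs v rewrite cells-reverse cs =
        to-≡ (cong (tape [] nothing) (reverse-cells cs))
          (back-path q (reverse cs) nothing []
            (subst (_≤ S) (cong (2 +_) (sym (trans (ℕ.+-identityʳ _) (List.length-reverse cs)))) v))

      length-run : ∀ q cs → length (proj₂ (run q cs)) ≡ length cs
      length-run q []       = refl
      length-run q (c ∷ cs) = cong suc (length-run _ cs)

      end-path : ∀ {i} q cs g → 3 + length cs ≤ S →
        Path w S (sweep P) (proj₁ (atEnd q g))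
             (i , moveTape nothing (proj₂ (proj₂ (atEnd q g)))
                    (tape (map just cs ʳ++ [ nothing ]) (proj₁ (proj₂ (atEnd q g))) [])) []
             (inj₂ (result q)) (i , rest (cs ++ fromMaybe g))
      end-path q cs nothing v rewrite List.++-identityʳ cs = turn-path q cs (ℕ.<⇒≤ v)
      end-path {i} q cs (just c) v = go
        (subst (λ k → suc k ≤ S) (sym visited-turn) v)
        (from-≡ (cong (λ ls → moveTape nothing left (tape ls nothing [])) (sym snoc-cells))
          (turn-path q (cs ++ [ c ]) (subst (λ k → 2 + k ≤ S) (sym length-snoc) v)))
        where
        length-snoc : length (cs ++ [ c ]) ≡ suc (length cs)
        length-snoc = trans (List.length-++ cs) (ℕ.+-comm _ 1)
        visited-turn : suc (length (map just cs ʳ++ [ nothing ])) + 0 ≡ 2 + length cs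
        visited-turn = trans (ℕ.+-identityʳ _) (cong suc (trans (List.length-ʳ++ (map just cs))
          (trans (ℕ.+-comm _ 1) (cong suc (List.length-map just cs)))))
        snoc-cells : map just (cs ++ [ c ]) ʳ++ [ nothing ] ≡ just c ∷ (map just cs ʳ++ [ nothing ])
        snoc-cells = trans (cong (_ʳ++ [ nothing ]) (List.map-++ just cs [ c ])) (List.++-ʳ++ (map just cs))

      -- The constant 3 pays for the two end blanks and for one column that the pass may append.
      sweep-⇒ : ∀ i cs → 3 + length cs ≤ S →
        let (q , cs′) = run q₀ cs in
        sweep P ⊢ (i , rest cs) ⇒[ [] ] result q , (i , rest (cs′ ++ fromMaybe (append q)))
      sweep-⇒ i cs v = go
        (subst (_≤ S) (cong suc (sym (trans (List.length-++ (map just cs))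
          (trans (ℕ.+-comm _ 1) (cong suc (List.length-map just cs)))))) (ℕ.<⇒≤ v))
        (from-≡ (scan-right [] nothing cs)
          (trans-Path w S (sweep P) (scan-path q₀ [ nothing ] cs (ℕ.<⇒≤ v)) (go
            (subst (λ k → suc k ≤ S) (sym visited-end) (ℕ.<⇒≤ v))
            (end-path q cs′ (append q) (subst (λ k → 3 + k ≤ S) (sym (length-run q₀ cs)) v)))))
        where
        q = proj₁ (run q₀ cs)
        cs′ = proj₂ (run q₀ cs)
        visited-end : length (map just cs′ ʳ++ [ nothing ]) + 0 ≡ suc (length cs)
        visited-end = trans (ℕ.+-identityʳ _) (trans (List.length-ʳ++ (map just cs′))
          (trans (ℕ.+-comm _ 1) (cong suc (trans (List.length-map just cs′) (length-run q₀ cs)))))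

-- Loop programs

data Program (d : ℕ) : Set where
  skip      : Program d
  emit      : Symbol → Program d
  _⨾_       : Program d → Program d → Program d
  for_loop_ : Fin d → Program (suc d) → Program d

infixr 5 _⨾_
infix 6 for_loop_

concatUpTo : {A : Set} → (ℕ → List A) → ℕ → List A
concatUpTo f zero    = []
concatUpTo f (suc n) = concatUpTo f n ++ f n

⟪_⟫ : ∀ {d} → Program d → Vec ℕ d → List Symbol
⟪ skip ⟫         env = []
⟪ emit b ⟫       env = [ b ]
⟪ P ⨾ Q ⟫        env = ⟪ P ⟫ env ++ ⟪ Q ⟫ env
⟪ for y loop P ⟫ env = concatUpTo (λ i → ⟪ P ⟫ (i ∷ env)) (lookup env y)

-- The largest number of variables in scope where a loop opens. If it is at most `r`, then `suc r`
-- tracks hold these variables together with the new loop counter.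
height : ∀ {d} → Program d → ℕ
height skip               = 0
height (emit _)           = 0
height (P ⨾ Q)            = height P ⊔ height Q
height {d} (for _ loop P) = d ⊔ height P

-- Counters on the tape

column : ∀ {d} r → Vec ℕ d → Vec Bool r
column zero    _        = []
column (suc r) []       = false ∷ column r []
column (suc r) (n ∷ ns) = odd n ∷ column r ns

track : ∀ {r} → ℕ → Vec Bool r → Bool
track _       []       = false
track zero    (b ∷ bs) = b
track (suc y) (b ∷ bs) = track y bs

track-column : ∀ {d} r (env : Vec ℕ d) (y : Fin d) → d ≤ r →
  track (toℕ y) (column r env) ≡ odd (lookup env y)
track-column (suc r) (n ∷ env) zero    d≤r       = refl
track-column (suc r) (n ∷ env) (suc y) (s≤s d≤r) = track-column r env y d≤r

shiftIn : ∀ {r} → Bool → Vec Bool r → Vec Bool r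
shiftIn b []       = []
shiftIn b (c ∷ cs) = b ∷ shiftIn c cs

shiftIn-column : ∀ {d} r n (env : Vec ℕ d) → shiftIn (odd n) (column r env) ≡ column r (n ∷ env)
shiftIn-column zero    n env       = refl
shiftIn-column (suc r) n []        = cong (odd n ∷_) (trans (shiftIn-column r 0 []) (zeros r))
  where
  zeros : ∀ r → column r (0 ∷ []) ≡ column r []
  zeros zero    = refl
  zeros (suc r) = refl
shiftIn-column (suc r) n (k ∷ env) = cong (odd n ∷_) (shiftIn-column r k env)

column-[] : ∀ r → column r [] ≡ Vec.replicate r false
column-[] zero    = refl
column-[] (suc r) = cong (false ∷_) (column-[] r)

column-∷ʳ : ∀ {d} r (env : Vec ℕ d) → d ≤ r → column r env ∷ʳ false ≡ column (suc r) env
column-∷ʳ zero    []        _         = refl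
column-∷ʳ (suc r) []        _         = cong (false ∷_) (column-∷ʳ r [] z≤n)
column-∷ʳ (suc r) (n ∷ env) (s≤s d≤r) = cong (odd n ∷_) (column-∷ʳ r env d≤r)

-- Comparison from the least significant digit on: `q` is the verdict so far, and a later pair of
-- differing digits overrides it.
lessBit : Bool → Bool → Bool → Bool
lessBit false true  _ = true
lessBit true  false _ = false
lessBit _     _     q = q

lessBit-refl : ∀ b q → lessBit b b q ≡ q
lessBit-refl false q = refl
lessBit-refl true  q = refl

module Counters (r : ℕ) where
  open Machine r

  -- Least significant digits first; the tracks beyond the d counters hold 0.
  counters : ∀ {d} → ℕ → Vec ℕ d → List Column
  counters zero    env = []
  counters (suc L) env = column (suc r) env ∷ counters L (Vec.map ⌊_/2⌋ env)

  length-counters : ∀ {d} L (env : Vec ℕ d) → length (counters L env) ≡ L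
  length-counters zero    env = refl
  length-counters (suc L) env = cong suc (length-counters L _)

  push pop increment : Pass ⊤
  push = record { Q = ⊤ ; finite = finite-⊤ ; q₀ = tt ; f = λ q c → q , shiftIn false c
                ; append = λ _ → nothing ; result = id }
  pop = record { Q = ⊤ ; finite = finite-⊤ ; q₀ = tt ; f = λ { q (_ ∷ c) → q , c ∷ʳ false }
               ; append = λ _ → nothing ; result = id }
  increment = record
    { Q = Bool ; finite = finite-Bool ; q₀ = true
    ; f = λ { carry (b ∷ c) → carry ∧ b , (carry xor b) ∷ c }
    ; append = λ carry → if carry then just (true ∷ Vec.replicate r false) else nothing
    ; result = λ _ → tt }

  less : ℕ → Pass Bool
  less y = record
    { Q = Bool ; finite = finite-Bool ; q₀ = false
    ; f = λ { q (b ∷ c) → lessBit b (track y c) q , b ∷ c }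
    ; append = λ _ → nothing ; result = id }

  -- The innermost loop counter is always track 0: entering a loop shifts all tracks.
  compile : ∀ {d} → Program d → Fragment ⊤
  compile skip           = idle
  compile (emit b)       = write b
  compile (P ⨾ Q)        = compile P then compile Q
  compile (for y loop P) =
    sweep push then (while sweep (less (toℕ y)) loop (compile P then sweep increment)) then sweep pop

  run-push : ∀ {d} L (env : Vec ℕ d) →
    Pass.run push tt (counters L env) ≡ (tt , counters L (0 ∷ env))
  run-push zero    env = refl
  run-push (suc L) env = cong₂ (λ c (q , cs) → q , c ∷ cs)
    (shiftIn-column (suc r) 0 env) (run-push L (Vec.map ⌊_/2⌋ env))

  -- The track put back at the end holds 0, in agreement with `env`, because `d ≤ r` leaves the last
  -- track free.
  run-pop : ∀ {d} L n (env : Vec ℕ d) → d ≤ r →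
    Pass.run pop tt (counters L (n ∷ env)) ≡ (tt , counters L env)
  run-pop zero    n env d≤r = refl
  run-pop (suc L) n env d≤r = cong₂ (λ c (q , cs) → q , c ∷ cs)
    (column-∷ʳ r env d≤r) (run-pop L ⌊ n /2⌋ (Vec.map ⌊_/2⌋ env) d≤r)

  -- An arbitrary incoming carry is needed for the induction, since the next column receives the
  -- carry `c ∧ odd n` and the number `⌊ n /2⌋`. The bound makes the final carry 0, so no column is
  -- appended.
  run-increment : ∀ {d} L c n (env : Vec ℕ d) → bit c + n < 2 ^ L →
    Pass.run increment c (counters L (n ∷ env)) ≡ (false , counters L (bit c + n ∷ env))
  run-increment zero    false n env _         = refl
  run-increment zero    true  n env (s≤s ())
  run-increment (suc L) c     n env lt = cong₂ (λ b (q , cs) → q , (b ∷ column r env) ∷ cs)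
    (sym (odd-bit+ c n))
    (trans (run-increment L (c ∧ odd n) ⌊ n /2⌋ (Vec.map ⌊_/2⌋ env)
             (subst (_< 2 ^ L) (half-bit+ c n) (half-< (bit c + n) lt)))
           (cong (λ k → false , counters L (k ∷ Vec.map ⌊_/2⌋ env)) (sym (half-bit+ c n))))

  -- The counter overflows its L digits exactly when it reaches 2 ^ L.
  run-increment-overflow : ∀ L c n → n < 2 ^ L → bit c + n ≡ 2 ^ L →
    let (q , cs) = Pass.run increment c (counters L (n ∷ [])) in
    q ≡ true × cs ++ [ true ∷ Vec.replicate r false ] ≡ counters (suc L) (bit c + n ∷ [])
  run-increment-overflow zero    false zero _  ()
  run-increment-overflow zero    true  zero _  _  =
    refl , cong (λ c → [ true ∷ c ]) (sym (column-[] r))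
  run-increment-overflow zero    c     (suc n) (s≤s ()) _
  run-increment-overflow (suc L) c     n lt eq =
    let (q≡true , cs≡) = run-increment-overflow L (c ∧ odd n) ⌊ n /2⌋ (half-< n lt)
          (trans (sym (half-bit+ c n)) (trans (cong ⌊_/2⌋ eq) (half-2* (2 ^ L))))
    in q≡true , cong₂ _∷_ (cong (_∷ column r []) (sym (odd-bit+ c n)))
         (trans cs≡ (cong (λ k → counters (suc L) (k ∷ [])) (sym (half-bit+ c n))))

  run-less-≡ : ∀ {d} L q n (env : Vec ℕ d) y → d ≤ r → n ≡ lookup env y →
    Pass.run (less (toℕ y)) q (counters L (n ∷ env)) ≡ (q , counters L (n ∷ env))
  run-less-≡ zero    q n env y d≤r eq = refl
  run-less-≡ (suc L) q n env y d≤r eq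
    rewrite track-column r env y d≤r | sym eq | lessBit-refl (odd n) q =
    cong (λ (q , cs) → q , column (suc r) (n ∷ env) ∷ cs)
      (run-less-≡ L q ⌊ n /2⌋ (Vec.map ⌊_/2⌋ env) y d≤r
        (trans (cong ⌊_/2⌋ eq) (sym (Vec.lookup-map y ⌊_/2⌋ env))))

  -- If the halves are already in strict order, the higher digits decide whatever this digit says.
  -- Otherwise the halves agree, this digit sets the verdict to `true`, and `run-less-≡` carries it
  -- to the end.
  run-less-< : ∀ {d} L q n (env : Vec ℕ d) y → d ≤ r → n < lookup env y → lookup env y < 2 ^ L →
    Pass.run (less (toℕ y)) q (counters L (n ∷ env)) ≡ (true , counters L (n ∷ env))
  run-less-< zero q n env y d≤r lt (s≤s le) with lookup env y
  run-less-< zero q n env y d≤r () (s≤s z≤n) | zero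
  run-less-< (suc L) q n env y d≤r lt bound
    with lookup env y in eq | half-<⊎≡ lt
  ... | m | inj₁ lt′ = cong (λ (q , cs) → q , column (suc r) (n ∷ env) ∷ cs)
      (run-less-< L _ ⌊ n /2⌋ (Vec.map ⌊_/2⌋ env) y d≤r
        (subst (⌊ n /2⌋ <_) (sym half-y) lt′) (subst (_< 2 ^ L) (sym half-y) (half-< m bound)))
    where half-y = trans (Vec.lookup-map y ⌊_/2⌋ env) (cong ⌊_/2⌋ eq)
  ... | m | inj₂ (eq′ , p , p′)
    rewrite track-column r env y d≤r | eq | p | p′ =
      cong (λ (q , cs) → q , (false ∷ column r env) ∷ cs)
        (run-less-≡ L true ⌊ n /2⌋ (Vec.map ⌊_/2⌋ env) y d≤r
          (trans eq′ (sym (trans (Vec.lookup-map y ⌊_/2⌋ env) (cong ⌊_/2⌋ eq)))))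

  module _ {w : List ⊤} {S : ℕ} where

    sweep-counters : ∀ {E d} (P : Pass E) i L {d′} (env : Vec ℕ d) (env′ : Vec ℕ d′) {q} →
      3 + L ≤ S → Pass.run P (Pass.q₀ P) (counters L env) ≡ (q , counters L env′) →
      Pass.append P q ≡ nothing →
      Path w S (sweep P) (inj₁ (Fragment.start (sweep P))) (i , rest (counters L env)) []
        (inj₂ (Pass.result P q)) (i , rest (counters L env′))
    sweep-counters P i L env env′ v eq no-append
      with Pass.run P (Pass.q₀ P) (counters L env)
         | sweep-⇒ {w} {S} P i (counters L env) (subst (λ k → 3 + k ≤ S) (sym (length-counters L env)) v)
    sweep-counters P i L env env′ v refl no-append | _ | p
      rewrite no-append | List.++-identityʳ (counters L env′) = p

    visited-rest : ∀ {d} L (env : Vec ℕ d) → 3 + L ≤ S →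
      Tape.visited (rest (counters L env)) ≤ S
    visited-rest L env v = ℕ.≤-trans (s≤s (ℕ.≤-reflexive
      (trans (List.length-++ (map just (counters L env))) (trans (ℕ.+-comm _ 1) (cong suc
        (trans (List.length-map just (counters L env)) (length-counters L env)))))))
      (ℕ.<⇒≤ v)

    -- A loop counter never exceeds the value of an earlier variable, so all counters stay at most
    -- `n`. As `n < 2 ^ L`, no increment overflows: the number of columns remains `L` and each sweep
    -- fits into `3 + L` cells.
    compile-⇒ : ∀ {d} (P : Program d) (env : Vec ℕ d) i L n → height P ≤ r →
      VecAll.All (_≤ n) env → n < 2 ^ L → 3 + L ≤ S →
      _⊢_⇒[_]_,_ {w} {S} (compile P) (i , rest (counters L env)) (⟪ P ⟫ env) tt (i , rest (counters L env))
    compile-⇒ skip     env i L n h env≤ n< v = go (visited-rest L env v) stop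
    compile-⇒ (emit b) env i L n h env≤ n< v = go (visited-rest L env v) stop
    compile-⇒ (P ⨾ Q)  env i L n h env≤ n< v = then-⇒ (compile P) (compile Q)
      (compile-⇒ P env i L n (ℕ.m⊔n≤o⇒m≤o _ _ h) env≤ n< v)
      (compile-⇒ Q env i L n (ℕ.m⊔n≤o⇒n≤o (height P) _ h) env≤ n< v)
    compile-⇒ {d} (for y loop P) env i L n h env≤ n< v =
      subst (λ o → _⊢_⇒[_]_,_ {w} {S} _ _ o _ _) (trans (List.++-identityʳ _) (List.++-identityʳ _))
        (then-⇒ (sweep push) _
          (sweep-counters push i L env (0 ∷ env) v (run-push L env) refl)
          (then-⇒ loop (sweep pop)
            -- The last test compares equal numbers, so the verdict remains the initial `false` and
            -- the loop is left.
            (trans-Path w S loop (iterate bound ℕ.≤-refl) (while-test (sweep test) body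
              (sweep-counters test i L (bound ∷ env) (bound ∷ env) v
                (run-less-≡ L false bound env y d≤r refl) refl)))
            (sweep-counters pop i L (bound ∷ env) env v (run-pop L bound env d≤r) refl)))
      where
      test = less (toℕ y)
      body = compile P then sweep increment
      loop = while sweep test loop body
      bound = lookup env y
      d≤r = ℕ.m⊔n≤o⇒m≤o d _ h
      bound≤n : bound ≤ n
      bound≤n = VecAll.lookup⁺ env≤ y
      iterate : ∀ k → k ≤ bound → Path w S loop (inj₁ (Fragment.start loop))
        (i , rest (counters L (0 ∷ env))) (concatUpTo (λ j → ⟪ P ⟫ (j ∷ env)) k)
        (inj₁ (Fragment.start loop)) (i , rest (counters L (k ∷ env)))
      iterate zero    _   = stop
      iterate (suc k) k<  = trans-Path w S loop (iterate k (ℕ.<⇒≤ k<))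
        (while-iterate (sweep test) body
          (sweep-counters test i L (k ∷ env) (k ∷ env) v
             (run-less-< L false k env y d≤r k< (ℕ.≤-<-trans bound≤n n<)) refl)
          (subst (λ o → _⊢_⇒[_]_,_ {w} {S} body _ o tt _) (List.++-identityʳ _)
            (then-⇒ (compile P) (sweep increment)
              (compile-⇒ P (k ∷ env) i L n (ℕ.m⊔n≤o⇒n≤o d _ h)
                (ℕ.≤-trans (ℕ.<⇒≤ k<) bound≤n ∷ env≤) n< v)
              (sweep-counters increment i L (k ∷ env) (suc k ∷ env) v
                (run-increment L true k env (ℕ.≤-<-trans (ℕ.≤-trans k< bound≤n) n<)) refl))))

-- The number of binary digits.

digits : ℕ → ℕ
digits zero    = 0
-- A digit is added only on overflow, just as the tape grows under `increment`.
digits (suc n) with suc n ℕ.<? 2 ^ digits n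
... | yes _ = digits n
... | no _  = suc (digits n)

n<2^digits : ∀ n → n < 2 ^ digits n
n<2^digits zero    = s≤s z≤n
n<2^digits (suc n) with suc n ℕ.<? 2 ^ digits n
... | yes lt = lt
... | no _   = ℕ.≤-<-trans (n<2^digits n)
  (ℕ.<-≤-trans (ℕ.m<m*n (2 ^ digits n) 2 {{ℕ.m^n≢0 2 (digits n)}} (s≤s (s≤s z≤n)))
    (ℕ.≤-reflexive (ℕ.*-comm (2 ^ digits n) 2)))

digits-suc : ∀ n → digits n ≤ digits (suc n)
digits-suc n with suc n ℕ.<? 2 ^ digits n
... | yes _ = ℕ.≤-refl
... | no _  = ℕ.n≤1+n _

digits-mono : ∀ {m n} → m ≤ n → digits m ≤ digits n
digits-mono {m} {n} m≤n = go (ℕ.≤⇒≤′ m≤n)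
  where
  go : ∀ {n} → m ℕ.≤′ n → digits m ≤ digits n
  go (ℕ.≤′-reflexive refl) = ℕ.≤-refl
  go (ℕ.≤′-step {n} le)    = ℕ.≤-trans (go le) (digits-suc n)

-- A digit is added only when `2 ^ digits n ≤ suc n`; taking logarithms bounds the old number of
-- digits by `⌈log₂ suc n ⌉`.
digits≤1+log : ∀ n → digits n ≤ suc ⌈log₂ n ⌉
digits≤1+log zero    = z≤n
digits≤1+log (suc n) with suc n ℕ.<? 2 ^ digits n
... | yes _  = ℕ.≤-trans (digits≤1+log n) (s≤s (⌈log₂⌉-mono-≤ (ℕ.n≤1+n n)))
... | no n≮ = s≤s (subst (_≤ ⌈log₂ suc n ⌉) (⌈log₂2^n⌉≡n (digits n)) (⌈log₂⌉-mono-≤ (ℕ.≮⇒≥ n≮)))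

-- Counting the input length in binary.

module Initialise (r : ℕ) where
  open Machine r
  open Counters r

  -- The initial tape stores a single cell. Visiting its right neighbour turns it into `rest []`,
  -- the shape that sweeps expect.
  makeBlank : Fragment ⊤
  makeBlank = record
    { State = Bool ; finite = finite-Bool ; start = true
    ; step = λ { true  _ x → inj₁ false , stay , (x , right) , nothing
               ; false _ x → inj₂ tt , stay , (x , left) , nothing } }

  readSymbol : Fragment Bool
  readSymbol = record
    { State = ⊤ ; finite = finite-⊤ ; start = tt
    ; step = λ { _ (InputCell.sym _) x → inj₂ true , right , (x , stay) , nothing
               ; _ _       x → inj₂ false , stay , (x , stay) , nothing } }

  countInput : Fragment ⊤
  countInput = makeBlank then (while readSymbol loop sweep increment)

  readInput-inside : ∀ (w : List ⊤) {i} → i < length w → readInput w (suc i) ≡ InputCell.sym tt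
  readInput-inside (tt ∷ w) {zero}  _       = refl
  readInput-inside (_ ∷ w) {suc i} (s≤s i<) = readInput-inside w i<

  readInput-end : ∀ (w : List ⊤) → readInput w (suc (length w)) ≡ ⊣
  readInput-end []      = refl
  readInput-end (_ ∷ w) = readInput-end w

  module _ {w : List ⊤} {S : ℕ} (v : 3 + digits (length w) ≤ S) where

    go-read : ∀ {E} {F : Fragment E} {q i t a out q′ m} → readInput w i ≡ a → Tape.visited t ≤ S →
      let (s , d , (y , e) , b) = Fragment.step F q a (Tape.scanned t) in
      Path w S F s (moveInput w d i , moveTape nothing e (writeTape y t)) out q′ m →
      Path w S F (inj₁ q) (i , t) (fromMaybe b ++ out) q′ m
    go-read refl u p = go u p

    private
      counting : Fragment ⊤
      counting = while readSymbol loop sweep increment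

    increment-⇒ : ∀ i n → suc n ≤ length w →
      _⊢_⇒[_]_,_ {w} {S} (sweep increment) (i , rest (counters (digits n) (n ∷ []))) [] tt
        (i , rest (counters (digits (suc n)) (suc n ∷ [])))
    increment-⇒ i n n< with suc n ℕ.<? 2 ^ digits n
    ... | yes lt = sweep-counters increment i (digits n) (n ∷ []) (suc n ∷ [])
      (ℕ.≤-trans (ℕ.+-monoʳ-≤ 3 (digits-mono (ℕ.<⇒≤ n<))) v)
      (run-increment (digits n) true n [] lt) refl
    -- Here `suc n` equals `2 ^ digits n`, so the carry leaves the last column and a new column is
    -- appended.
    ... | no n≮
      with Pass.run increment true (counters (digits n) (n ∷ []))
         | run-increment-overflow (digits n) true n (n<2^digits n)
             (ℕ.≤-antisym (n<2^digits n) (ℕ.≮⇒≥ n≮))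
         | sweep-⇒ {w} {S} increment i (counters (digits n) (n ∷ []))
             (subst (λ k → 3 + k ≤ S) (sym (length-counters (digits n) (n ∷ [])))
               (ℕ.≤-trans (ℕ.+-monoʳ-≤ 3 (digits-mono (ℕ.<⇒≤ n<))) v))
    ... | _ , cs | refl , eq | p = to-≡ (cong rest eq) p

    readSymbol-true : ∀ n L → n < length w → L ≤ digits (length w) →
      _⊢_⇒[_]_,_ {w} {S} readSymbol (suc n , rest (counters L (n ∷ []))) [] true
        (suc (suc n) , rest (counters L (n ∷ [])))
    readSymbol-true n L n< L≤ = go-read (readInput-inside w n<)
      (visited-rest {w} L (n ∷ []) (ℕ.≤-trans (ℕ.+-monoʳ-≤ 3 L≤) v))
      (subst (λ i → Path w S readSymbol (inj₂ true) (suc i , rest (counters L (n ∷ []))) [] _ _)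
        (sym (ℕ.m≤n⇒m⊓n≡m n<)) stop)

    count : ∀ n → n ≤ length w → Path w S counting (inj₁ (Fragment.start counting))
      (1 , rest []) [] (inj₁ (Fragment.start counting))
      (suc n , rest (counters (digits n) (n ∷ [])))
    -- No column at all represents 0, since `digits 0` is 0.
    count zero    _  = stop
    count (suc n) n< = trans-Path w S counting (count n (ℕ.<⇒≤ n<))
      (while-iterate readSymbol (sweep increment)
        (readSymbol-true n (digits n) n< (digits-mono (ℕ.<⇒≤ n<)))
        (increment-⇒ (suc (suc n)) n n<))

    countInput-⇒ : _⊢_⇒[_]_,_ {w} {S} countInput (1 , tape [] nothing []) [] tt
      (suc (length w) , rest (counters (digits (length w)) (length w ∷ [])))
    countInput-⇒ = then-⇒ makeBlank counting
      (go (ℕ.≤-trans (s≤s z≤n) v) (go (ℕ.≤-trans (s≤s (s≤s z≤n)) v) stop))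
      (trans-Path w S counting (count (length w) ℕ.≤-refl) (while-test readSymbol (sweep increment)
        (go-read (readInput-end w) (visited-rest {w} (digits (length w)) (length w ∷ []) v) stop)))

  transducer : Fragment ⊤ → Transducer ⊤ Symbol
  transducer F = record
    { State = F.State ⊎ ⊤ ; stateFinite = finite-⊎ F.finite finite-⊤
    ; Γ = Γ ; Γ-finite = finite-Maybe (finite-Vec finite-Bool (suc r)) ; blank = nothing
    ; #tapes = 1 ; start = inj₁ F.start
    ; δ = λ { (inj₁ q) a (x ∷ []) →
                let (q′ , d , move , b) = F.step q a x in just (action q′ d (move ∷ []) b)
            ; (inj₂ _) _ _ → nothing } }
    where module F = Fragment F

  run-transducer : ∀ F {w S q i t o i′ t′} → Path w S F q (i , t) o (inj₂ tt) (i′ , t′) →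
    Tape.visited t′ ≤ S → Transducer.Run (transducer F) S w (config q i (t ∷ [])) o
  run-transducer F stop     v = Transducer.halt (λ { zero → v }) refl
  run-transducer F (go u p) v = Transducer.step (λ { zero → u }) refl (run-transducer F p v)

program-logspace : (P : Program 1) →
  ∃[ M ] LogspaceComputes M (λ (w : List ⊤) → ⟪ P ⟫ (length w ∷ []))
-- The 4 collects the 3 extra cells of a sweep and the 1 in `digits n ≤ suc ⌈log₂ n ⌉`.
program-logspace P = transducer machine , 4 , λ w →
  let n = length w
      v = ℕ.≤-trans (ℕ.+-monoʳ-≤ 3 (digits≤1+log n)) (four ⌈log₂ n ⌉)
  in run-transducer machine
       (then-⇒ countInput (compile P) (countInput-⇒ v)
         (compile-⇒ P (n ∷ []) _ (digits n) n ℕ.≤-refl (ℕ.≤-refl ∷ []) (n<2^digits n) v))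
       (visited-rest {w} (digits n) (n ∷ []) v)
  where
  open Machine (height P)
  open Counters (height P)
  open Initialise (height P)
  machine = countInput then compile P
  four : ∀ m → 4 + m ≤ 4 * suc m
  four m = subst (4 + m ≤_) (sym (ℕ.*-suc 4 m)) (ℕ.+-monoʳ-≤ 4 (ℕ.m≤n*m m 4))

-- Repetition of lists.

copies : {A : Set} → ℕ → List A → List A
copies n xs = concatUpTo (λ _ → xs) n

concatUpTo-cong : {A : Set} {f g : ℕ → List A} → (∀ i → f i ≡ g i) → ∀ n → concatUpTo f n ≡ concatUpTo g n
concatUpTo-cong f≗g zero    = refl
concatUpTo-cong f≗g (suc n) = cong₂ _++_ (concatUpTo-cong f≗g n) (f≗g n)

copies-+ : {A : Set} (m n : ℕ) (xs : List A) → copies (m + n) xs ≡ copies m xs ++ copies n xs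
copies-+ m zero    xs = trans (cong (λ k → copies k xs) (ℕ.+-identityʳ m)) (sym (List.++-identityʳ _))
copies-+ m (suc n) xs = trans (cong (λ k → copies k xs) (ℕ.+-suc m n))
  (trans (cong (_++ xs) (copies-+ m n xs)) (List.++-assoc (copies m xs) _ _))

copies-* : {A : Set} (m n : ℕ) (xs : List A) → copies (m * n) xs ≡ copies m (copies n xs)
copies-* zero    n xs = refl
copies-* (suc m) n xs = trans (cong (λ k → copies k xs) (ℕ.+-comm n (m * n)))
  (trans (copies-+ (m * n) n xs) (cong (_++ copies n xs) (copies-* m n xs)))

copies-[] : {A : Set} (n : ℕ) (x : A) → copies n [ x ] ≡ replicate n x
copies-[] zero    x = refl
copies-[] (suc n) x = trans (cong (_++ [ x ]) (copies-[] n x)) (snoc n)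
  where
  snoc : ∀ n → replicate n x ++ [ x ] ≡ x ∷ replicate n x
  snoc zero    = refl
  snoc (suc n) = cong (x ∷_) (snoc n)

-- Renaming variables

lift : ∀ {d d′} → (Fin d → Fin d′) → Fin (suc d) → Fin (suc d′)
lift ρ zero    = zero
lift ρ (suc y) = suc (ρ y)

rename : ∀ {d d′} → (Fin d → Fin d′) → Program d → Program d′
rename ρ skip           = skip
rename ρ (emit b)       = emit b
rename ρ (P ⨾ Q)        = rename ρ P ⨾ rename ρ Q
rename ρ (for y loop P) = for ρ y loop rename (lift ρ) P

⟪rename⟫ : ∀ {d d′} (ρ : Fin d → Fin d′) (P : Program d) {env env′} →
  (∀ y → lookup env′ (ρ y) ≡ lookup env y) → ⟪ rename ρ P ⟫ env′ ≡ ⟪ P ⟫ env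
⟪rename⟫ ρ skip     eq = refl
⟪rename⟫ ρ (emit b) eq = refl
⟪rename⟫ ρ (P ⨾ Q)  eq = cong₂ _++_ (⟪rename⟫ ρ P eq) (⟪rename⟫ ρ Q eq)
⟪rename⟫ ρ (for y loop P) {env} eq rewrite eq y = concatUpTo-cong
  (λ i → ⟪rename⟫ (lift ρ) P (λ { zero → refl ; (suc y) → eq y })) (lookup env y)

-- Polynomials and unary output of polynomial length.

data Polynomial (d : ℕ) : Set where
  lit     : ℕ → Polynomial d
  var     : Fin d → Polynomial d
  _⊕_ _⊗_ : Polynomial d → Polynomial d → Polynomial d

infixl 6 _⊕_
infixl 7 _⊗_

value : ∀ {d} → Polynomial d → Vec ℕ d → ℕ
value (lit k) env = k
value (var y) env = lookup env y
value (e ⊕ f) env = value e env + value f env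
value (e ⊗ f) env = value e env * value f env

substitute : ∀ {d d′} → (Fin d → Fin d′) → Polynomial d → Polynomial d′
substitute ρ (lit k) = lit k
substitute ρ (var y) = var (ρ y)
substitute ρ (e ⊕ f) = substitute ρ e ⊕ substitute ρ f
substitute ρ (e ⊗ f) = substitute ρ e ⊗ substitute ρ f

value-substitute : ∀ {d d′} (ρ : Fin d → Fin d′) e {env env′} →
  (∀ y → lookup env′ (ρ y) ≡ lookup env y) → value (substitute ρ e) env′ ≡ value e env
value-substitute ρ (lit k) eq = refl
value-substitute ρ (var y) eq = eq y
value-substitute ρ (e ⊕ f) eq = cong₂ _+_ (value-substitute ρ e eq) (value-substitute ρ f eq)
value-substitute ρ (e ⊗ f) eq = cong₂ _*_ (value-substitute ρ e eq) (value-substitute ρ f eq)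

-- In the absence of subtraction a polynomial is monotone, so every variable may be raised to `n`.
value-≤ : ∀ {d} (e : Polynomial d) {n env} → VecAll.All (_≤ n) env →
  value e env ≤ value (substitute (λ _ → zero) e) (n ∷ [])
value-≤ (lit k) env≤ = ℕ.≤-refl
value-≤ (var y) env≤ = VecAll.lookup⁺ env≤ y
value-≤ (e ⊕ f) env≤ = ℕ.+-mono-≤ (value-≤ e env≤) (value-≤ f env≤)
value-≤ (e ⊗ f) env≤ = ℕ.*-mono-≤ (value-≤ e env≤) (value-≤ f env≤)

times : ∀ {d} → ℕ → Program d → Program d
times zero    P = skip
times (suc k) P = times k P ⨾ P

-- Sums become sequences and products become nested repetition, so wire numbers are printed in unary
-- without ever being computed on the tape.
repeat : ∀ {d} → Polynomial d → Program d → Program d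
repeat (lit k) P = times k P
repeat (var y) P = for y loop rename suc P
repeat (e ⊕ f) P = repeat e P ⨾ repeat f P
repeat (e ⊗ f) P = repeat e (repeat f P)

⟪repeat⟫ : ∀ {d} (e : Polynomial d) P env → ⟪ repeat e P ⟫ env ≡ copies (value e env) (⟪ P ⟫ env)
⟪repeat⟫ (lit k) P env = go k
  where
  go : ∀ k → ⟪ times k P ⟫ env ≡ copies k (⟪ P ⟫ env)
  go zero    = refl
  go (suc k) = cong (_++ ⟪ P ⟫ env) (go k)
⟪repeat⟫ (var y) P env = concatUpTo-cong (λ i → ⟪rename⟫ suc P (λ _ → refl)) (lookup env y)
⟪repeat⟫ (e ⊕ f) P env = trans (cong₂ _++_ (⟪repeat⟫ e P env) (⟪repeat⟫ f P env))
  (sym (copies-+ (value e env) (value f env) _))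
⟪repeat⟫ (e ⊗ f) P env = trans (⟪repeat⟫ e (repeat f P) env)
  (trans (cong (copies (value e env)) (⟪repeat⟫ f P env)) (sym (copies-* (value e env) (value f env) _)))

-- Each loop contributes at most one more factor. The base is `suc n` because its powers grow with
-- the exponent even for `n = 0`; a sequence can then be bounded by adding the exponents.
length-⟪⟫ : ∀ {d} (P : Program d) → ∃[ c ] ∃[ e ] (∀ n env → VecAll.All (_≤ n) env →
  length (⟪ P ⟫ env) ≤ c * suc n ^ e)
length-⟪⟫ skip     = 0 , 0 , λ _ _ _ → z≤n
length-⟪⟫ (emit _) = 1 , 0 , λ _ _ _ → ℕ.≤-refl
length-⟪⟫ (P ⨾ Q) with length-⟪⟫ P | length-⟪⟫ Q
... | c , e , P≤ | c′ , e′ , Q≤ = c + c′ , e + e′ , λ n env env≤ → begin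
  length (⟪ P ⟫ env ++ ⟪ Q ⟫ env)                   ≡⟨ List.length-++ (⟪ P ⟫ env) ⟩
  length (⟪ P ⟫ env) + length (⟪ Q ⟫ env)           ≤⟨ ℕ.+-mono-≤ (P≤ n env env≤) (Q≤ n env env≤) ⟩
  c * suc n ^ e + c′ * suc n ^ e′                   ≤⟨ ℕ.+-mono-≤
      (ℕ.*-monoʳ-≤ c (ℕ.^-monoʳ-≤ (suc n) (ℕ.m≤m+n e e′)))
      (ℕ.*-monoʳ-≤ c′ (ℕ.^-monoʳ-≤ (suc n) (ℕ.m≤n+m e′ e))) ⟩
  c * suc n ^ (e + e′) + c′ * suc n ^ (e + e′)      ≡⟨ ℕ.*-distribʳ-+ _ c c′ ⟨
  (c + c′) * suc n ^ (e + e′)                       ∎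
  where open ℕ.≤-Reasoning
length-⟪⟫ (for y loop P) with length-⟪⟫ P
... | c , e , P≤ = c , suc e , λ n env env≤ →
  let y≤n = VecAll.lookup⁺ env≤ y in begin
  length (concatUpTo (λ i → ⟪ P ⟫ (i ∷ env)) (lookup env y)) ≤⟨ iterate n env env≤ (lookup env y) y≤n ⟩
  lookup env y * (c * suc n ^ e)                     ≤⟨ ℕ.*-monoˡ-≤ _ (ℕ.m≤n⇒m≤1+n y≤n) ⟩
  suc n * (c * suc n ^ e)                            ≡⟨ ℕ.*-comm (suc n) _ ⟩
  c * suc n ^ e * suc n                              ≡⟨ ℕ.*-assoc c _ _ ⟩
  c * (suc n ^ e * suc n)                            ≡⟨ cong (c *_) (ℕ.*-comm _ (suc n)) ⟩
  c * suc n ^ suc e                                  ∎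
  where
  open ℕ.≤-Reasoning
  iterate : ∀ n env → VecAll.All (_≤ n) env → ∀ k → k ≤ n →
    length (concatUpTo (λ i → ⟪ P ⟫ (i ∷ env)) k) ≤ k * (c * suc n ^ e)
  iterate n env env≤ zero    _  = z≤n
  iterate n env env≤ (suc k) k< = begin
    length (concatUpTo (λ i → ⟪ P ⟫ (i ∷ env)) k ++ ⟪ P ⟫ (k ∷ env))
      ≡⟨ List.length-++ (concatUpTo (λ i → ⟪ P ⟫ (i ∷ env)) k) ⟩
    length (concatUpTo (λ i → ⟪ P ⟫ (i ∷ env)) k) + length (⟪ P ⟫ (k ∷ env))
      ≤⟨ ℕ.+-mono-≤ (iterate n env env≤ k (ℕ.<⇒≤ k<)) (P≤ n (k ∷ env) (ℕ.<⇒≤ k< ∷ env≤)) ⟩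
    k * (c * suc n ^ e) + c * suc n ^ e
      ≡⟨ ℕ.+-comm _ (c * suc n ^ e) ⟩
    suc k * (c * suc n ^ e) ∎

length-polynomial : (P : Program 1) → ∃[ c ] ∃[ e ] (∀ n → length (⟪ P ⟫ (n ∷ [])) ≤ c * n ^ e + c)
length-polynomial P with length-⟪⟫ P
-- The factor `2 ^ e` comes from `suc n ≤ 2 * n` for positive `n`; the additive constant covers
-- `n = 0`.
... | c , e , P≤ = c * 2 ^ e , e , λ n → ℕ.≤-trans (P≤ n (n ∷ []) (ℕ.≤-refl ∷ [])) (bound n)
  where
  open ℕ.≤-Reasoning
  bound : ∀ n → c * suc n ^ e ≤ c * 2 ^ e * n ^ e + c * 2 ^ e
  bound zero = begin
    c * 1 ^ e                 ≤⟨ ℕ.*-monoʳ-≤ c (ℕ.^-monoˡ-≤ e (s≤s z≤n)) ⟩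
    c * 2 ^ e                 ≤⟨ ℕ.m≤n+m _ _ ⟩
    c * 2 ^ e * 0 ^ e + c * 2 ^ e ∎
  bound n@(suc m) = begin
    c * suc n ^ e             ≤⟨ ℕ.*-monoʳ-≤ c (ℕ.^-monoˡ-≤ e
                                   (ℕ.+-mono-≤ {1} {n} (s≤s z≤n) (ℕ.m≤m+n n 0))) ⟩
    c * (2 * n) ^ e           ≡⟨ cong (c *_) (distrib e) ⟩
    c * (2 ^ e * n ^ e)       ≡⟨ ℕ.*-assoc c _ _ ⟨
    c * 2 ^ e * n ^ e         ≤⟨ ℕ.m≤m+n _ _ ⟩
    c * 2 ^ e * n ^ e + c * 2 ^ e ∎
    where
    distrib : ∀ e → (2 * n) ^ e ≡ 2 ^ e * n ^ e
    distrib zero    = refl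
    distrib (suc e) = trans (cong (2 * n *_) (distrib e)) (ℕ.[m*n]*[o*p]≡[m*o]*[n*p] 2 n (2 ^ e) (n ^ e))

-- Threshold formulas and their gate blocks.

nth : List Bool → ℕ → Bool
nth []       _       = false
nth (b ∷ _)  zero    = b
nth (_ ∷ bs) (suc i) = nth bs i

count : (ℕ → Bool) → ℕ → ℕ
count f zero    = 0
count f (suc n) = bit (f n) + count f n

-- Uniform threshold formulas over the bits of a word; `atLeast k y φ` says that φ
-- holds for at least k values of a new variable below y.  Bits beyond the end are 0.
data Formula (d : ℕ) : Set where
  bitAt   : Polynomial d → Formula d
  neg     : Formula d → Formula d
  _&_     : Formula d → Formula d → Formula d
  atLeast : Polynomial d → Fin d → Formula (suc d) → Formula d

infixr 6 _&_

⟦_⟧ : ∀ {d} → Formula d → List Bool → Vec ℕ d → Bool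
⟦ bitAt e ⟧       w env = nth w (value e env)
⟦ neg φ ⟧         w env = not (⟦ φ ⟧ w env)
⟦ φ & ψ ⟧         w env = ⟦ φ ⟧ w env ∧ ⟦ ψ ⟧ w env
⟦ atLeast k y φ ⟧ w env =
  does (value k env ℕ.≤? count (λ i → ⟦ φ ⟧ w (i ∷ env)) (lookup env y))

-- The gates of a formula form a block ending with its root.  The variable of the two
-- polynomials is the input length.
before blockSize : ∀ {d} → Formula d → Polynomial 1
before (bitAt _)       = lit 0
before (neg φ)         = blockSize φ
before (φ & ψ)         = blockSize φ ⊕ blockSize ψ
before (atLeast _ _ φ) = var zero ⊗ blockSize φ
blockSize φ = before φ ⊕ lit 1

-- Enough padding for every bit that the formula may refer to.
reach : ∀ {d} → Formula d → Polynomial 1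
reach (bitAt e)       = substitute (λ _ → zero) e
reach (neg φ)         = reach φ
reach (φ & ψ)         = reach φ ⊕ reach ψ
reach (atLeast _ _ φ) = reach φ

-- A bound on the depth of a block. Inputs, padding and the constant 1 have depth at most 2, hence 3
-- for a gate that copies a bit.
rank : ∀ {d} → Formula d → ℕ
rank (bitAt _)       = 3
rank (neg φ)         = suc (rank φ)
rank (φ & ψ)         = suc (rank φ ⊔ rank ψ)
rank (atLeast _ _ φ) = suc (rank φ)

2≤rank : ∀ {d} (φ : Formula d) → 2 ≤ rank φ
2≤rank (bitAt _)       = s≤s (s≤s z≤n)
2≤rank (neg φ)         = ℕ.m≤n⇒m≤1+n (2≤rank φ)
2≤rank (φ & ψ)         = ℕ.m≤n⇒m≤1+n (ℕ.≤-trans (2≤rank φ) (ℕ.m≤m⊔n _ _))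
2≤rank (atLeast _ _ φ) = ℕ.m≤n⇒m≤1+n (2≤rank φ)

module Blocks (n : ℕ) (zeroWire oneWire : ℕ) where

  -- Wire numbers are absolute, and `a` is the first wire of the block. As the inputs are the first
  -- wires and are followed by zeros, the bit at a position is the wire of the same number.
  root : ∀ {d} → Formula d → Vec ℕ d → ℕ → Gate ℕ
  root (bitAt e)       env a = MAJ [ value e env ]
  root (neg φ)         env a = NOT (a + value (before φ) (n ∷ []))
  root (φ & ψ)         env a =
    MAJ (a + value (before φ) (n ∷ []) ∷ a + value (blockSize φ ⊕ before ψ) (n ∷ []) ∷ zeroWire ∷ [])
  root (atLeast k y φ) env a = MAJ
    (oneWire ∷
     concatUpTo (λ i → a + (i * value (blockSize φ) (n ∷ []) + value (before φ) (n ∷ [])) ∷ oneWire ∷ [])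
       (lookup env y) ++
     copies (value k env) (zeroWire ∷ zeroWire ∷ []))

  inner block : ∀ {d} → Formula d → Vec ℕ d → ℕ → List (Gate ℕ)
  inner (bitAt e)       env a = []
  inner (neg φ)         env a = block φ env a
  inner (φ & ψ)         env a = block φ env a ++ block ψ env (a + value (blockSize φ) (n ∷ []))
  inner (atLeast k y φ) env a =
    concatUpTo (λ i → block φ (i ∷ env) (a + i * value (blockSize φ) (n ∷ []))) n
  block φ env a = inner φ env a ++ [ root φ env a ]

-- Evaluation of gates

-- A relation on natural positions rather than a lookup by `Fin`: a known wire keeps its number when
-- further wires are appended, with no conversion of types.
data _[_]=_ {A : Set} : List A → ℕ → A → Set where
  here  : ∀ {x xs} → (x ∷ xs) [ 0 ]= x
  there : ∀ {x y xs i} → xs [ i ]= y → (x ∷ xs) [ suc i ]= y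

module _ {A : Set} where
  []=-++ˡ : ∀ {xs : List A} {i x} ys → xs [ i ]= x → (xs ++ ys) [ i ]= x
  []=-++ˡ ys here      = here
  []=-++ˡ ys (there p) = there ([]=-++ˡ ys p)

  []=-++ʳ : ∀ (xs : List A) {ys i x} → ys [ i ]= x → (xs ++ ys) [ length xs + i ]= x
  []=-++ʳ []       p = p
  []=-++ʳ (_ ∷ xs) p = there ([]=-++ʳ xs p)

  []=⇒< : ∀ {xs : List A} {i x} → xs [ i ]= x → i < length xs
  []=⇒< here      = s≤s z≤n
  []=⇒< (there p) = s≤s ([]=⇒< p)

-- The value of a wire together with its depth.
Wire : Set
Wire = Bool × ℕ

maxDepth : List Wire → ℕ
maxDepth ws = foldr _⊔_ 0 (map proj₂ ws)

data Output (vs : List Wire) : Gate ℕ → Wire → Set where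
  MAJ : ∀ {is ws} → Pointwise (vs [_]=_) is ws →
        Output vs (MAJ is) (majority (map proj₁ ws) , suc (maxDepth ws))
  NOT : ∀ {i b δ} → vs [ i ]= (b , δ) → Output vs (NOT i) (not b , suc δ)

-- A gate can be run only if all its inputs occur among the earlier wires, so a run also certifies
-- that the gate list is well formed.
data Steps (vs : List Wire) : List (Gate ℕ) → List Wire → Set where
  []  : Steps vs [] vs
  _∷_ : ∀ {g gs x vs′} → Output vs g x → Steps (vs ++ [ x ]) gs vs′ → Steps vs (g ∷ gs) vs′

Steps-++ : ∀ {vs gs vs′ hs vs″} → Steps vs gs vs′ → Steps vs′ hs vs″ → Steps vs (gs ++ hs) vs″
Steps-++ []      t = t
Steps-++ (o ∷ s) t = o ∷ Steps-++ s t

-- Majority gates as threshold gates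

countTrue : List Bool → ℕ
countTrue bs = length (filter (Bool._≟ true) bs)

countTrue-∷ : ∀ b bs → countTrue (b ∷ bs) ≡ bit b + countTrue bs
countTrue-∷ false bs = refl
countTrue-∷ true  bs = refl

countTrue-++ : ∀ bs cs → countTrue (bs ++ cs) ≡ countTrue bs + countTrue cs
countTrue-++ bs cs = trans (cong length (List.filter-++ (Bool._≟ true) bs cs)) (List.length-++ (filter (Bool._≟ true) bs))

majority-single : ∀ b → majority [ b ] ≡ b
majority-single false = refl
majority-single true  = refl

majority-∧ : ∀ b c → majority (b ∷ c ∷ false ∷ []) ≡ b ∧ c
majority-∧ false false = refl
majority-∧ false true  = refl
majority-∧ true  false = refl
majority-∧ true  true  = refl

-- With m inputs of which t are 1, adding m + 1 ones and 2 k zeros leads to a majority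
-- iff 2 m + 1 + 2 k < 2 (t + m + 1), that is, iff k ≤ t.
majority-threshold : ∀ (f : ℕ → Bool) m k →
  majority (true ∷ concatUpTo (λ i → f i ∷ true ∷ []) m ++ copies k (false ∷ false ∷ []))
    ≡ does (k ℕ.≤? count f m)
majority-threshold f m k = does-⇔ (mk⇔ forwards backwards) (_ ℕ.<? _) (_ ℕ.≤? _)
  where
  body zeros : List Bool
  body  = concatUpTo (λ i → f i ∷ true ∷ []) m
  zeros = copies k (false ∷ false ∷ [])
  t = count f m
  length-body : ∀ m → length (concatUpTo (λ i → f i ∷ true ∷ []) m) ≡ 2 * m
  length-body zero    = refl
  length-body (suc m) = trans (List.length-++ (concatUpTo _ m))
    (trans (cong (_+ 2) (length-body m)) (trans (ℕ.+-comm _ 2) (sym (ℕ.*-suc 2 m))))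
  length-zeros : ∀ k → length (copies k (false ∷ false ∷ [])) ≡ 2 * k
  length-zeros zero    = refl
  length-zeros (suc k) = trans (List.length-++ (copies k _))
    (trans (cong (_+ 2) (length-zeros k)) (trans (ℕ.+-comm _ 2) (sym (ℕ.*-suc 2 k))))
  countTrue-body : ∀ m → countTrue (concatUpTo (λ i → f i ∷ true ∷ []) m) ≡ m + count f m
  countTrue-body zero    = refl
  countTrue-body (suc m) = begin
    countTrue (concatUpTo _ m ++ f m ∷ true ∷ [])  ≡⟨ countTrue-++ (concatUpTo _ m) _ ⟩
    countTrue (concatUpTo _ m) + countTrue (f m ∷ true ∷ [])
      ≡⟨ cong₂ _+_ (countTrue-body m) (countTrue-∷ (f m) _) ⟩
    (m + count f m) + (bit (f m) + 1)              ≡⟨ arithmetic m (count f m) (bit (f m)) ⟩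
    suc m + (bit (f m) + count f m)                ∎
    where
    open ≡-Reasoning
    arithmetic : ∀ m c b → (m + c) + (b + 1) ≡ suc m + (b + c)
    arithmetic = solve-∀
  countTrue-zeros : ∀ k → countTrue (copies k (false ∷ false ∷ [])) ≡ 0
  countTrue-zeros zero    = refl
  countTrue-zeros (suc k) = trans (countTrue-++ (copies k _) _)
    (trans (ℕ.+-identityʳ _) (countTrue-zeros k))
  lengths : length (true ∷ body ++ zeros) ≡ suc (2 * (m + k))
  lengths = cong suc (trans (List.length-++ body) (trans (cong₂ _+_ (length-body m) (length-zeros k))
    (sym (ℕ.*-distribˡ-+ 2 m k))))
  trues : countTrue (true ∷ body ++ zeros) ≡ suc (m + t)
  trues = cong suc (trans (countTrue-++ body zeros)
    (trans (cong₂ _+_ (countTrue-body m) (countTrue-zeros k)) (ℕ.+-identityʳ _)))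
  twice : 2 * countTrue (true ∷ body ++ zeros) ≡ 2 + 2 * (m + t)
  twice = trans (cong (2 *_) trues) (ℕ.*-suc 2 (m + t))
  forwards : length (true ∷ body ++ zeros) < 2 * countTrue (true ∷ body ++ zeros) → k ≤ t
  forwards lt = ℕ.+-cancelˡ-≤ m k t (ℕ.*-cancelˡ-≤ 2
    (ℕ.≤-pred (ℕ.≤-pred (subst₂ _<_ lengths twice lt))))
  backwards : k ≤ t → length (true ∷ body ++ zeros) < 2 * countTrue (true ∷ body ++ zeros)
  backwards k≤t = subst₂ _<_ (sym lengths) (sym twice)
    (s≤s (s≤s (ℕ.*-monoʳ-≤ 2 (ℕ.+-monoʳ-≤ m k≤t))))

-- Values and depths in the block of a formula.

maxDepth-≤ : ∀ {m ws} → All (λ x → proj₂ x ≤ m) ws → maxDepth ws ≤ m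
maxDepth-≤ []         = z≤n
maxDepth-≤ (x≤ ∷ ws≤) = ℕ.⊔-lub x≤ (maxDepth-≤ ws≤)

MAJ-≡ : ∀ {vs is ws b} → Pointwise (vs [_]=_) is ws → majority (map proj₁ ws) ≡ b →
  Output vs (MAJ is) (b , suc (maxDepth ws))
MAJ-≡ ps refl = MAJ ps

Bounded : ℕ → List Wire → Set
Bounded m = All (λ x → proj₂ x ≤ m)

weaken : ∀ {m m′ vs} → m ≤ m′ → Bounded m vs → Bounded m′ vs
weaken m≤m′ = All.map (λ x≤m → ℕ.≤-trans x≤m m≤m′)

module Evaluation (w : List Bool) (n D : ℕ) where
  open Blocks n n (n + D)

  blockSize′ before′ : ∀ {d} → Formula d → ℕ
  blockSize′ φ   = value (blockSize φ) (n ∷ [])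
  before′ φ = value (before φ) (n ∷ [])

  -- The wires that all blocks share: the inputs, then `D` zeros of which the first also serves as
  -- the constant 0, then the constant 1 obtained by negating it.
  record Base (vs : List Wire) : Set where
    field
      zeroAt  : vs [ n ]= (false , 1)
      oneAt   : vs [ n + D ]= (true , 2)
      inputAt : ∀ i → i < n + D → ∃[ δ ] (δ ≤ 2 × vs [ i ]= (nth w i , δ))
  open Base

  Base-++ : ∀ {vs} us → Base vs → Base (vs ++ us)
  Base-++ us B = record
    { zeroAt  = []=-++ˡ us (zeroAt B)
    ; oneAt   = []=-++ˡ us (oneAt B)
    ; inputAt = λ i i< → let (δ , δ≤2 , at) = inputAt B i i< in δ , δ≤2 , []=-++ˡ us at }

  record Evaluated {d} (φ : Formula d) (env : Vec ℕ d) (vs : List Wire) (a : ℕ) : Set where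
    field
      added     : List Wire
      steps     : Steps vs (block φ env a) (vs ++ added)
      length-≡  : length added ≡ blockSize′ φ
      bounded   : Bounded (rank φ) added
      rootDepth : ℕ
      rootDepth≤ : rootDepth ≤ rank φ
      rootAt    : added [ before′ φ ]= (⟦ φ ⟧ w env , rootDepth)
  open Evaluated

  []=-block : ∀ {vs us a i} {x : Wire} → a ≡ length vs → us [ i ]= x → (vs ++ us) [ a + i ]= x
  []=-block {vs} refl at = []=-++ʳ vs at

  close : ∀ {d} (φ : Formula d) {env vs a us δ} → Steps vs (inner φ env a) (vs ++ us) →
    length us ≡ before′ φ → Bounded (rank φ) us →
    Output (vs ++ us) (root φ env a) (⟦ φ ⟧ w env , δ) → δ ≤ rank φ → Evaluated φ env vs a
  close φ {env} {vs} {us = us} {δ} s l us≤ o δ≤ = record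
    { added      = us ++ [ ⟦ φ ⟧ w env , δ ]
    ; steps      = Steps-++ s (subst (Steps _ _) (List.++-assoc vs us _) (o ∷ []))
    ; length-≡   = trans (List.length-++ us) (cong (_+ 1) l)
    ; bounded    = All.++⁺ us≤ (δ≤ ∷ [])
    ; rootDepth  = δ
    ; rootDepth≤ = δ≤
    ; rootAt     = subst (λ i → _ [ i ]= _) (trans (ℕ.+-identityʳ _) l) ([]=-++ʳ us here) }

  -- Induction on the formula. Since all variables are at most `n`, `value-≤` and the bound on
  -- `reach` show that each position asked for is an input or a padding wire.
  evaluate : ∀ {d} (φ : Formula d) {env vs a} → a ≡ length vs → Base vs → VecAll.All (_≤ n) env →
    value (reach φ) (n ∷ []) < D → Evaluated φ env vs a

  evaluate (bitAt e) {env} {vs} a≡ B env≤ reach<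
    with inputAt B (value e env) (ℕ.<-≤-trans (ℕ.≤-<-trans (value-≤ e env≤) reach<) (ℕ.m≤n+m D n))
  ... | δ , δ≤2 , at = close (bitAt e) (subst (Steps vs []) (sym (List.++-identityʳ vs)) []) refl []
    (MAJ-≡ ([]=-++ˡ [] at ∷ []) (majority-single (nth w (value e env))))
    (s≤s (ℕ.⊔-lub δ≤2 z≤n))

  evaluate (neg φ) {env} {vs} a≡ B env≤ reach< =
    close (neg φ) (steps r) (length-≡ r) (weaken (ℕ.n≤1+n _) (bounded r))
      (NOT ([]=-block a≡ (rootAt r))) (s≤s (rootDepth≤ r))
    where r = evaluate φ a≡ B env≤ reach<

  evaluate (φ & ψ) {env} {vs} {a} a≡ B env≤ reach< =
    close (φ & ψ)
      (subst (Steps vs _) (List.++-assoc vs _ _) (Steps-++ (steps r) (steps r′)))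
      (trans (List.length-++ (added r)) (cong₂ _+_ (length-≡ r) (length-≡ r′)))
      (All.++⁺ (weaken (ℕ.m≤n⇒m≤1+n (ℕ.m≤m⊔n (rank φ) (rank ψ))) (bounded r))
                (weaken (ℕ.m≤n⇒m≤1+n (ℕ.m≤n⊔m (rank φ) (rank ψ))) (bounded r′)))
      (MAJ-≡ ([]=-block {vs} a≡ ([]=-++ˡ (added r′) (rootAt r)) ∷
              []=-block {vs} a≡ ([]=-block {added r} (sym (length-≡ r)) (rootAt r′)) ∷
              []=-++ˡ _ (zeroAt B) ∷ [])
        (majority-∧ (⟦ φ ⟧ w env) (⟦ ψ ⟧ w env)))
      (s≤s (maxDepth-≤ {ws = (⟦ φ ⟧ w env , _) ∷ (⟦ ψ ⟧ w env , _) ∷ (false , 1) ∷ []}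
                       (ℕ.≤-trans (rootDepth≤ r) (ℕ.m≤m⊔n _ _) ∷
                        ℕ.≤-trans (rootDepth≤ r′) (ℕ.m≤n⊔m (rank φ) _) ∷
                        ℕ.≤-trans (s≤s z≤n) (ℕ.≤-trans (2≤rank φ) (ℕ.m≤m⊔n _ _)) ∷ [])))
    where
    r = evaluate φ a≡ B env≤ (ℕ.≤-<-trans (ℕ.m≤m+n _ _) reach<)
    r′ = evaluate ψ {vs = vs ++ added r}
      (trans (cong₂ _+_ a≡ (sym (length-≡ r))) (sym (List.length-++ vs)))
      (Base-++ (added r) B) env≤ (ℕ.≤-<-trans (ℕ.m≤n+m _ _) reach<)

  evaluate (atLeast k y φ) {env} {vs} {a} a≡ B env≤ reach< =
    close (atLeast k y φ) (Children.steps c) (Children.length-≡ c)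
      (weaken (ℕ.n≤1+n _) (Children.bounded c))
      (MAJ-≡ ([]=-++ˡ _ (oneAt B) ∷ Pointwise.++⁺ roots-at zeros-at)
        (trans (cong (λ bs → majority (true ∷ bs)) (trans (List.map-++ proj₁ roots zeros)
          (cong₂ _++_ roots-≡ zeros-≡)))
          (majority-threshold (λ i → ⟦ φ ⟧ w (i ∷ env)) (lookup env y) (value k env))))
      (s≤s (maxDepth-≤ {ws = (true , 2) ∷ roots ++ zeros} (2≤rank φ ∷ All.++⁺ roots≤ zeros≤)))
    where
    record Children (m : ℕ) : Set where
      field
        added    : List Wire
        steps    : Steps vs (concatUpTo (λ i → block φ (i ∷ env) (a + i * blockSize′ φ)) m) (vs ++ added)
        length-≡ : length added ≡ m * blockSize′ φ
        bounded  : Bounded (rank φ) added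
        rootAt   : ∀ i → i < m → ∃[ δ ] (δ ≤ rank φ ×
                   added [ i * blockSize′ φ + before′ φ ]= (⟦ φ ⟧ w (i ∷ env) , δ))

    children : ∀ m → m ≤ n → Children m
    children zero    _  = record
      { added = [] ; steps = subst (Steps vs []) (sym (List.++-identityʳ vs)) []
      ; length-≡ = refl ; bounded = [] ; rootAt = λ _ () }
    children (suc m) m< = record
      { added    = C.added ++ r.added
      ; steps    = subst (Steps vs _) (List.++-assoc vs _ _) (Steps-++ C.steps r.steps)
      ; length-≡ = trans (List.length-++ C.added) (trans (cong₂ _+_ C.length-≡ r.length-≡)
                     (ℕ.+-comm (m * blockSize′ φ) _))
      ; bounded  = All.++⁺ C.bounded r.bounded
      ; rootAt   = at }
      where
      module C = Children (children m (ℕ.<⇒≤ m<))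
      module r = Evaluated (evaluate φ {m ∷ env} {vs ++ C.added} {a + m * blockSize′ φ}
        (trans (cong₂ _+_ a≡ (sym C.length-≡)) (sym (List.length-++ vs)))
        (Base-++ C.added B) (ℕ.<⇒≤ m< ∷ env≤) reach<)
      at : ∀ i → i < suc m → ∃[ δ ] (δ ≤ rank φ ×
        (C.added ++ r.added) [ i * blockSize′ φ + before′ φ ]= (⟦ φ ⟧ w (i ∷ env) , δ))
      at i i<1+m with ℕ.m≤n⇒m<n∨m≡n (ℕ.≤-pred i<1+m)
      ... | inj₁ i<m  = let (δ , δ≤ , p) = C.rootAt i i<m in δ , δ≤ , []=-++ˡ r.added p
      ... | inj₂ refl = r.rootDepth , r.rootDepth≤ ,
        []=-block {C.added} (sym C.length-≡) r.rootAt

    c = children n ℕ.≤-refl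
    vs′ = vs ++ Children.added c

    collect-roots : ∀ m → m ≤ n → ∃[ ws ] (
      Pointwise (vs′ [_]=_) (concatUpTo (λ i → a + (i * blockSize′ φ + before′ φ) ∷ n + D ∷ []) m) ws ×
      map proj₁ ws ≡ concatUpTo (λ i → ⟦ φ ⟧ w (i ∷ env) ∷ true ∷ []) m ×
      Bounded (rank φ) ws)
    collect-roots zero    _  = [] , [] , refl , []
    collect-roots (suc m) m< with collect-roots m (ℕ.<⇒≤ m<) | Children.rootAt c m m<
    ... | ws , ps , ws≡ , ws≤ | δ , δ≤ , at =
      ws ++ (⟦ φ ⟧ w (m ∷ env) , δ) ∷ (true , 2) ∷ [] ,
      Pointwise.++⁺ ps ([]=-block a≡ at ∷ []=-++ˡ _ (oneAt B) ∷ []) ,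
      trans (List.map-++ proj₁ ws _) (cong (_++ _) ws≡) ,
      All.++⁺ ws≤ (δ≤ ∷ 2≤rank φ ∷ [])

    collect-zeros : ∀ m → ∃[ ws ] (
      Pointwise (vs′ [_]=_) (copies m (n ∷ n ∷ [])) ws ×
      map proj₁ ws ≡ copies m (false ∷ false ∷ []) ×
      Bounded (rank φ) ws)
    collect-zeros zero    = [] , [] , refl , []
    collect-zeros (suc m) with collect-zeros m
    ... | ws , ps , ws≡ , ws≤ =
      ws ++ (false , 1) ∷ (false , 1) ∷ [] ,
      Pointwise.++⁺ ps ([]=-++ˡ _ (zeroAt B) ∷ []=-++ˡ _ (zeroAt B) ∷ []) ,
      trans (List.map-++ proj₁ ws _) (cong (_++ _) ws≡) ,
      All.++⁺ ws≤ (1≤ ∷ 1≤ ∷ [])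
      where 1≤ = ℕ.≤-trans (s≤s z≤n) (2≤rank φ)

    -- The bound `y` is at most `n`, so the copies that the root gate reads are among those that
    -- were built.
    bound-roots = collect-roots (lookup env y) (VecAll.lookup⁺ env≤ y)
    roots    = proj₁ bound-roots
    roots-at = proj₁ (proj₂ bound-roots)
    roots-≡  = proj₁ (proj₂ (proj₂ bound-roots))
    roots≤   = proj₂ (proj₂ (proj₂ bound-roots))
    all-zeros = collect-zeros (value k env)
    zeros    = proj₁ all-zeros
    zeros-at = proj₁ (proj₂ all-zeros)
    zeros-≡  = proj₁ (proj₂ (proj₂ all-zeros))
    zeros≤   = proj₂ (proj₂ (proj₂ all-zeros))

-- Circuits from gate lists

WiresBelow : ℕ → Gate ℕ → Set
WiresBelow w (MAJ is) = All (_< w) is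
WiresBelow w (NOT i)  = i < w

data Valid (w : ℕ) : List (Gate ℕ) → Set where
  []  : Valid w []
  _∷_ : ∀ {g gs} → WiresBelow w g → Valid (suc w) gs → Valid w (g ∷ gs)

Pointwise⇒< : ∀ {vs : List Wire} {is ws} → Pointwise (vs [_]=_) is ws → All (_< length vs) is
Pointwise⇒< []       = []
Pointwise⇒< (p ∷ ps) = []=⇒< p ∷ Pointwise⇒< ps

Output⇒WiresBelow : ∀ {vs g x} → Output vs g x → WiresBelow (length vs) g
Output⇒WiresBelow (MAJ ps) = Pointwise⇒< ps
Output⇒WiresBelow (NOT p)  = []=⇒< p

Steps⇒Valid : ∀ {vs gs vs′} → Steps vs gs vs′ → Valid (length vs) gs
Steps⇒Valid []                = []
Steps⇒Valid {vs} {g ∷ gs} (o ∷ s) = Output⇒WiresBelow o ∷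
  subst (λ l → Valid l gs) (trans (List.length-++ vs) (ℕ.+-comm _ 1)) (Steps⇒Valid s)

toFins : ∀ {w is} → All (_< w) is → List (Fin w)
toFins []       = []
toFins (p ∷ ps) = Fin.fromℕ< p ∷ toFins ps

toGate : ∀ {w} (g : Gate ℕ) → WiresBelow w g → Gate (Fin w)
toGate (MAJ _) ps = MAJ (toFins ps)
toGate (NOT _) p  = NOT (Fin.fromℕ< p)

-- The first gate is kept apart so that the result visibly has a last wire, as `eval` requires.
extend : ∀ {N w} → Circuit N w → ∀ g gs → Valid w (g ∷ gs) → ∃[ w′ ] Circuit N (suc w′)
extend C g []       (p ∷ _) = _ , C ▷ toGate g p
extend C g (h ∷ gs) (p ∷ v) = extend (C ▷ toGate g p) h gs v

describeℕ : Gate ℕ → List Symbol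
describeℕ (MAJ is) = maj ∷ concatMap (λ i → replicate i one ++ [ end ]) is
describeℕ (NOT i)  = neg ∷ replicate i one ++ [ end ]

describe-toGate : ∀ {w} g (p : WiresBelow w g) → describeGate (toGate g p) ≡ describeℕ g
describe-toGate (NOT i) p  = cong (λ k → neg ∷ replicate k one ++ [ end ]) (Fin.toℕ-fromℕ< p)
describe-toGate (MAJ is) ps = cong (maj ∷_) (wires ps)
  where
  wires : ∀ {w is} (ps : All (_< w) is) →
    concatMap describeWire (toFins ps) ≡ concatMap (λ i → replicate i one ++ [ end ]) is
  wires []       = refl
  wires (p ∷ ps) = cong₂ (λ k l → (replicate k one ++ [ end ]) ++ l) (Fin.toℕ-fromℕ< p) (wires ps)

describe-extend : ∀ {N w} (C : Circuit N w) g gs v →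
  describe (proj₂ (extend C g gs v)) ≡ describe C ++ concatMap describeℕ (g ∷ gs)
describe-extend C g []       (p ∷ _) = cong (describe C ++_)
  (trans (describe-toGate g p) (sym (List.++-identityʳ _)))
describe-extend C g (h ∷ gs) (p ∷ v) = trans (describe-extend (C ▷ toGate g p) h gs v)
  (trans (List.++-assoc (describe C) _ _)
    (cong (λ l → describe C ++ l ++ concatMap describeℕ (h ∷ gs)) (describe-toGate g p)))

circuitSize≤ : ∀ {N w} (C : Circuit N w) → circuitSize C ≤ length (describe C)
circuitSize≤ inputs  = z≤n
circuitSize≤ (C ▷ g) = ℕ.≤-trans (ℕ.+-mono-≤ (circuitSize≤ C) (gate g))
  (ℕ.≤-reflexive (sym (List.length-++ (describe C))))
  where
  wire : ∀ {w} (i : Fin w) → 1 ≤ length (describeWire i)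
  wire i = ℕ.≤-trans (ℕ.m≤n+m 1 _) (ℕ.≤-reflexive (sym (List.length-++ (replicate (toℕ i) one))))
  wires : ∀ {w} (is : List (Fin w)) → length is ≤ length (concatMap describeWire is)
  wires []       = z≤n
  wires (i ∷ is) = ℕ.≤-trans (ℕ.+-mono-≤ (wire i) (wires is))
    (ℕ.≤-reflexive (sym (List.length-++ (describeWire i))))
  gate : ∀ {w} (g : Gate (Fin w)) → suc (fanIn g) ≤ length (describeGate g)
  gate (MAJ is) = s≤s (wires is)
  gate (NOT i)  = s≤s (wire i)

module _ {N : ℕ} (xs : Vec Bool N) where

  wires : ∀ {w} → Circuit N w → List Wire
  wires C = Vec.toList (Vec.zip (evalWires C xs) (wireDepths C))

  toList-zip-∷ʳ : ∀ {n} (as : Vec Bool n) (ds : Vec ℕ n) a d →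
    Vec.toList (Vec.zip (as ∷ʳ a) (ds ∷ʳ d)) ≡ Vec.toList (Vec.zip as ds) ++ [ a , d ]
  toList-zip-∷ʳ []        []       a d = refl
  toList-zip-∷ʳ (_ ∷ as) (_ ∷ ds) a d = cong (_ ∷_) (toList-zip-∷ʳ as ds a d)

  lookup-zip : ∀ {n i a d} (as : Vec Bool n) (ds : Vec ℕ n) → Vec.toList (Vec.zip as ds) [ i ]= (a , d) →
    (i< : i < n) → lookup as (Fin.fromℕ< i<) ≡ a × lookup ds (Fin.fromℕ< i<) ≡ d
  lookup-zip (_ ∷ as) (_ ∷ ds) here      i<       = refl , refl
  lookup-zip (_ ∷ as) (_ ∷ ds) (there p) (s≤s i<) = lookup-zip as ds p i<

  lookups-zip : ∀ {n is ws} (as : Vec Bool n) (ds : Vec ℕ n) →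
    Pointwise (Vec.toList (Vec.zip as ds) [_]=_) is ws → (is< : All (_< n) is) →
    map (lookup as) (toFins is<) ≡ map proj₁ ws × map (lookup ds) (toFins is<) ≡ map proj₂ ws
  lookups-zip as ds []       []          = refl , refl
  lookups-zip as ds (p ∷ ps) (i< ∷ is<) =
    let (eq₁ , eq₂) = lookup-zip as ds p i< ; (eqs₁ , eqs₂) = lookups-zip as ds ps is<
    in cong₂ _∷_ eq₁ eqs₁ , cong₂ _∷_ eq₂ eqs₂

  evalGate-≡ : ∀ {w} (C : Circuit N w) {g b δ} → Output (wires C) g (b , δ) → (p : WiresBelow w g) →
    evalGate (evalWires C xs) (toGate g p) ≡ b × gateDepth (wireDepths C) (toGate g p) ≡ δ
  evalGate-≡ C (MAJ ps) is< =
    let (eq₁ , eq₂) = lookups-zip (evalWires C xs) (wireDepths C) ps is<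
    in cong majority eq₁ , cong (λ ds → suc (foldr _⊔_ 0 ds)) eq₂
  evalGate-≡ C (NOT p)  i<  =
    let (eq₁ , eq₂) = lookup-zip (evalWires C xs) (wireDepths C) p i<
    in cong not eq₁ , cong suc eq₂

  wires-▷ : ∀ {w} (C : Circuit N w) {g x} → Output (wires C) g x → (p : WiresBelow w g) →
    wires (C ▷ toGate g p) ≡ wires C ++ [ x ]
  wires-▷ C o p = trans (toList-zip-∷ʳ (evalWires C xs) (wireDepths C) _ _)
    (let (eq₁ , eq₂) = evalGate-≡ C o p in cong₂ (λ b δ → wires C ++ [ b , δ ]) eq₁ eq₂)

  wires-extend : ∀ {w} (C : Circuit N w) {g gs vs} v → Steps (wires C) (g ∷ gs) vs →
    wires (proj₂ (extend C g gs v)) ≡ vs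
  wires-extend C {g} {[]}     (p ∷ v) (o ∷ [])      = wires-▷ C o p
  wires-extend C {g} {h ∷ gs} {vs} (p ∷ v) (o ∷ s) = wires-extend (C ▷ toGate g p) v
    (subst (λ ws → Steps ws (h ∷ gs) vs) (sym (wires-▷ C o p)) s)

  depth≤ : ∀ {w m} (C : Circuit N w) → Bounded m (wires C) → depth C ≤ m
  depth≤ {m = m} C = go (evalWires C xs) (wireDepths C)
    where
    go : ∀ {w} (as : Vec Bool w) (ds : Vec ℕ w) → Bounded m (Vec.toList (Vec.zip as ds)) →
      Vec.foldr _ _⊔_ 0 ds ≤ m
    go []       []       _          = z≤n
    go (_ ∷ as) (_ ∷ ds) (d≤ ∷ ds≤) = ℕ.⊔-lub d≤ (go as ds ds≤)

  eval-≡ : ∀ {w b δ} (C : Circuit N (suc w)) → wires C [ w ]= (b , δ) → eval C xs ≡ b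
  eval-≡ {w} C p = trans (last-lookup (evalWires C xs))
    (trans (cong (lookup (evalWires C xs)) (Fin.toℕ-injective (trans (Fin.toℕ-fromℕ w)
        (sym (Fin.toℕ-fromℕ< (ℕ.n<1+n w))))))
      (proj₁ (lookup-zip (evalWires C xs) (wireDepths C) p (ℕ.n<1+n w))))
    where
    lookup-∷ʳ : ∀ {n} (as : Vec Bool n) a → lookup (as ∷ʳ a) (Fin.fromℕ n) ≡ a
    lookup-∷ʳ []       a = refl
    lookup-∷ʳ (_ ∷ as) a = lookup-∷ʳ as a
    last-lookup : ∀ {n} (as : Vec Bool (suc n)) → Vec.last as ≡ lookup as (Fin.fromℕ n)
    last-lookup as with Vec.initLast as
    ... | as′ , a , refl = sym (lookup-∷ʳ as′ a)

-- Programs emitting the gates of a formula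

wireProgram : ∀ {d} → Polynomial d → Program d
wireProgram e = repeat e (emit one) ⨾ emit end

module _ (D : Polynomial 1) where

  -- `N` is the variable that holds the input length, and `a` is the address of the block as a
  -- polynomial in the variables in scope; both are shifted when a loop is entered.
  rootProgram innerProgram blockProgram : ∀ {d} → Formula d → Fin d → Polynomial d → Program d
  rootProgram (bitAt e)       N a = emit maj ⨾ wireProgram e
  rootProgram (neg φ)         N a = emit neg ⨾ wireProgram (a ⊕ substitute (λ _ → N) (before φ))
  rootProgram (φ & ψ)         N a = emit maj ⨾
    wireProgram (a ⊕ substitute (λ _ → N) (before φ)) ⨾
    wireProgram (a ⊕ substitute (λ _ → N) (blockSize φ ⊕ before ψ)) ⨾ wireProgram (var N)
  rootProgram (atLeast k y φ) N a = emit maj ⨾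
    wireProgram (var N ⊕ substitute (λ _ → N) D) ⨾
    for y loop
      (wireProgram (substitute suc a ⊕
         (var zero ⊗ substitute (λ _ → suc N) (blockSize φ) ⊕ substitute (λ _ → suc N) (before φ))) ⨾
       wireProgram (var (suc N) ⊕ substitute (λ _ → suc N) D)) ⨾
    repeat k (wireProgram (var N) ⨾ wireProgram (var N))

  innerProgram (bitAt e)       N a = skip
  innerProgram (neg φ)         N a = blockProgram φ N a
  innerProgram (φ & ψ)         N a =
    blockProgram φ N a ⨾ blockProgram ψ N (a ⊕ substitute (λ _ → N) (blockSize φ))
  innerProgram (atLeast k y φ) N a = for N loop
    blockProgram φ (suc N) (substitute suc a ⊕ var zero ⊗ substitute (λ _ → suc N) (blockSize φ))

  blockProgram φ N a = innerProgram φ N a ⨾ rootProgram φ N a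

⟪wireProgram⟫ : ∀ {d} (e : Polynomial d) env → ⟪ wireProgram e ⟫ env ≡ replicate (value e env) one ++ [ end ]
⟪wireProgram⟫ e env = cong (_++ [ end ]) (trans (⟪repeat⟫ e (emit one) env) (copies-[] (value e env) one))

concatMap-concatUpTo : {A B : Set} (g : A → List B) (f : ℕ → List A) (n : ℕ) →
  concatMap g (concatUpTo f n) ≡ concatUpTo (λ i → concatMap g (f i)) n
concatMap-concatUpTo g f zero    = refl
concatMap-concatUpTo g f (suc n) = trans (List.concatMap-++ g (concatUpTo f n) (f n))
  (cong (_++ concatMap g (f n)) (concatMap-concatUpTo g f n))

module Description (D : Polynomial 1) (n : ℕ) where
  open Blocks n n (n + value D (n ∷ []))

  wireℕ : ℕ → List Symbol
  wireℕ i = replicate i one ++ [ end ]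

  value-closed : ∀ {d} (e : Polynomial 1) (env : Vec ℕ d) N → lookup env N ≡ n →
    value (substitute (λ _ → N) e) env ≡ value e (n ∷ [])
  value-closed e env N N≡ = value-substitute (λ _ → N) e (λ { zero → N≡ })

  ⟪wire⟫ : ∀ {d} (e : Polynomial d) env {i} → value e env ≡ i → ⟪ wireProgram e ⟫ env ≡ wireℕ i
  ⟪wire⟫ e env refl = ⟪wireProgram⟫ e env

  ⟪wires₂⟫ : ∀ {d} (e f : Polynomial d) env {i j} → value e env ≡ i → value f env ≡ j →
    ⟪ wireProgram e ⨾ wireProgram f ⟫ env ≡ concatMap wireℕ (i ∷ j ∷ [])
  ⟪wires₂⟫ e f env i≡ j≡ = cong₂ _++_ (⟪wire⟫ e env i≡)
    (trans (⟪wire⟫ f env j≡) (sym (List.++-identityʳ _)))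

  describe-root : ∀ {d} (φ : Formula d) env N a {a′} → lookup env N ≡ n → value a env ≡ a′ →
    ⟪ rootProgram D φ N a ⟫ env ≡ describeℕ (root φ env a′)
  describe-root (bitAt e) env N a N≡ refl = cong (maj ∷_)
    (trans (⟪wire⟫ e env refl) (sym (List.++-identityʳ _)))
  describe-root (neg φ) env N a N≡ refl = cong (neg ∷_)
    (⟪wire⟫ (a ⊕ substitute (λ _ → N) (before φ)) env
      (cong (value a env +_) (value-closed (before φ) env N N≡)))
  describe-root (φ & ψ) env N a N≡ refl = cong (maj ∷_)
    (cong₂ _++_ (⟪wire⟫ (a ⊕ substitute (λ _ → N) (before φ)) env
      (cong (value a env +_) (value-closed (before φ) env N N≡)))
      (⟪wires₂⟫ (a ⊕ substitute (λ _ → N) (blockSize φ ⊕ before ψ)) (var N) env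
        (cong (value a env +_) (value-closed (blockSize φ ⊕ before ψ) env N N≡)) N≡))
  describe-root (atLeast k y φ) env N a N≡ refl = cong (maj ∷_)
    (cong₂ _++_ (⟪wire⟫ (var N ⊕ substitute (λ _ → N) D) env (cong₂ _+_ N≡ (value-closed D env N N≡)))
      (trans (cong₂ _++_ roots zeros) (sym (List.concatMap-++ wireℕ rootWires zeroWires))))
    where
    open ≡-Reasoning
    rootWire : ℕ → List ℕ
    rootWire i = value a env + (i * value (blockSize φ) (n ∷ []) + value (before φ) (n ∷ [])) ∷
                 n + value D (n ∷ []) ∷ []
    rootWires zeroWires : List ℕ
    rootWires = concatUpTo rootWire (lookup env y)
    zeroWires = copies (value k env) (n ∷ n ∷ [])
    rootAddress oneAddress : Polynomial _
    rootAddress = substitute suc a ⊕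
      (var zero ⊗ substitute (λ _ → suc N) (blockSize φ) ⊕ substitute (λ _ → suc N) (before φ))
    oneAddress  = var (suc N) ⊕ substitute (λ _ → suc N) D
    roots : concatUpTo (λ i → ⟪ wireProgram rootAddress ⨾ wireProgram oneAddress ⟫ (i ∷ env)) (lookup env y)
            ≡ concatMap wireℕ rootWires
    roots = trans
      (concatUpTo-cong (λ i → ⟪wires₂⟫ rootAddress oneAddress (i ∷ env)
        (cong₂ _+_ (value-substitute suc a (λ _ → refl))
          (cong₂ _+_ (cong (i *_) (value-closed (blockSize φ) (i ∷ env) (suc N) N≡))
                     (value-closed (before φ) (i ∷ env) (suc N) N≡)))
        (cong₂ _+_ N≡ (value-closed D (i ∷ env) (suc N) N≡))) (lookup env y))
      (sym (concatMap-concatUpTo wireℕ rootWire (lookup env y)))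
    zeros : ⟪ repeat k (wireProgram (var N) ⨾ wireProgram (var N)) ⟫ env ≡ concatMap wireℕ zeroWires
    zeros = begin
      ⟪ repeat k (wireProgram (var N) ⨾ wireProgram (var N)) ⟫ env
        ≡⟨ ⟪repeat⟫ k (wireProgram (var N) ⨾ wireProgram (var N)) env ⟩
      copies (value k env) (⟪ wireProgram (var N) ⨾ wireProgram (var N) ⟫ env)
        ≡⟨ cong (copies (value k env)) (⟪wires₂⟫ (var N) (var N) env N≡ N≡) ⟩
      copies (value k env) (concatMap wireℕ (n ∷ n ∷ []))
        ≡⟨ concatMap-concatUpTo wireℕ (λ _ → n ∷ n ∷ []) (value k env) ⟨
      concatMap wireℕ zeroWires ∎

  describe-inner : ∀ {d} (φ : Formula d) env N a {a′} → lookup env N ≡ n → value a env ≡ a′ →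
    ⟪ innerProgram D φ N a ⟫ env ≡ concatMap describeℕ (inner φ env a′)
  describe-block : ∀ {d} (φ : Formula d) env N a {a′} → lookup env N ≡ n → value a env ≡ a′ →
    ⟪ blockProgram D φ N a ⟫ env ≡ concatMap describeℕ (block φ env a′)
  describe-inner (bitAt e)       env N a N≡ a≡ = refl
  describe-inner (neg φ)         env N a N≡ a≡ = describe-block φ env N a N≡ a≡
  describe-inner (φ & ψ)         env N a {a′} N≡ a≡ = trans
    (cong₂ _++_ (describe-block φ env N a N≡ a≡)
      (describe-block ψ env N (a ⊕ _) N≡ (cong₂ _+_ a≡ (value-closed (blockSize φ) env N N≡))))
    (sym (List.concatMap-++ describeℕ (block φ env a′) _))
  describe-inner (atLeast k y φ) env N a N≡ a≡ rewrite N≡ = trans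
    (concatUpTo-cong (λ i → describe-block φ (i ∷ env) (suc N) (substitute suc a ⊕ _) N≡
      (cong₂ _+_ (trans (value-substitute suc a (λ _ → refl)) a≡)
        (cong (i *_) (value-closed (blockSize φ) (i ∷ env) (suc N) N≡)))) n)
    (sym (concatMap-concatUpTo describeℕ _ n))
  describe-block φ env N a {a′} N≡ a≡ = trans
    (cong₂ _++_ (describe-inner φ env N a N≡ a≡)
      (trans (describe-root φ env N a N≡ a≡) (sym (List.++-identityʳ _))))
    (sym (List.concatMap-++ describeℕ (inner φ env a′) _))

-- The uniform circuit family of a formula.

LogspaceComputes-cong : {A B : Set} (M : Transducer A B) {f g : List A → List B} →
  (∀ w → f w ≡ g w) → LogspaceComputes M f → LogspaceComputes M g
LogspaceComputes-cong M f≗g (c , run) = c , λ w →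
  subst (Transducer.Run M (c * suc ⌈log₂ length w ⌉) w (Transducer.initial M)) (f≗g w) (run w)

module Family (φ : Formula 1) where

  D : Polynomial 1
  -- The extra 1 makes the bound on positions strict and guarantees a zero wire, from which the
  -- constant 1 is derived.
  D = lit 1 ⊕ reach φ

  padding : ℕ → ℕ
  padding n = value (reach φ) (n ∷ [])

  start : ℕ → ℕ
  start n = n + suc (padding n) + 1

  -- One padding gate is missing here: it is the separate first gate given to `extend`.
  gates : ℕ → List (Gate ℕ)
  gates n = replicate (padding n) (MAJ []) ++
    NOT n ∷ Blocks.block n n (n + suc (padding n)) φ (n ∷ []) (start n)

  circuitProgram : Program 1
  circuitProgram = repeat D (emit maj) ⨾ emit neg ⨾ wireProgram (var zero) ⨾
    blockProgram D φ zero (var zero ⊕ D ⊕ lit 1)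

  describe-gates : ∀ n → ⟪ circuitProgram ⟫ (n ∷ []) ≡ concatMap describeℕ (MAJ [] ∷ gates n)
  describe-gates n = begin
    ⟪ repeat D (emit maj) ⟫ (n ∷ []) ++ neg ∷ (⟪ wireProgram (var zero) ⟫ (n ∷ []) ++
      ⟪ blockProgram D φ zero (var zero ⊕ D ⊕ lit 1) ⟫ (n ∷ []))
      ≡⟨ cong₂ _++_ (trans (⟪repeat⟫ D (emit maj) (n ∷ [])) (trans (copies-[] (suc (padding n)) maj) (sym (pads (suc (padding n))))))
           (cong (neg ∷_) (cong₂ _++_ (⟪wireProgram⟫ (var zero) (n ∷ []))
             (Description.describe-block D n φ (n ∷ []) zero (var zero ⊕ D ⊕ lit 1) refl refl))) ⟩
    concatMap describeℕ (replicate (suc (padding n)) (MAJ [])) ++ concatMap describeℕ rest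
      ≡⟨ List.concatMap-++ describeℕ (replicate (suc (padding n)) (MAJ [])) rest ⟨
    concatMap describeℕ (MAJ [] ∷ gates n) ∎
    where
    open ≡-Reasoning
    rest = NOT n ∷ Blocks.block n n (n + suc (padding n)) φ (n ∷ []) (start n)
    pads : ∀ m → concatMap describeℕ (replicate m (MAJ [])) ≡ replicate m maj
    pads zero    = refl
    pads (suc m) = cong (maj ∷_) (pads m)

  module Values (w : List Bool) where
    n : ℕ
    n = length w

    inputs₀ pads base : List Wire
    inputs₀ = map (_, 0) w
    pads = replicate (suc (padding n)) (false , 1)
    base = (inputs₀ ++ pads) ++ [ true , 2 ]

    length-pads : length (inputs₀ ++ pads) ≡ n + suc (padding n)
    length-pads = trans (List.length-++ inputs₀) (cong₂ _+_ (List.length-map _ w) (List.length-replicate _))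

    length-base : length base ≡ start n
    length-base = trans (List.length-++ (inputs₀ ++ pads)) (cong (_+ 1) length-pads)

    open Evaluation w n (suc (padding n))

    padded : ∀ i → i < n + suc (padding n) → ∃[ δ ] (δ ≤ 2 × (inputs₀ ++ pads) [ i ]= (nth w i , δ))
    padded = go w
      where
      pad : ∀ m i → i < m → replicate {A = Wire} m (false , 1) [ i ]= (false , 1)
      pad (suc m) zero    _        = here
      pad (suc m) (suc i) (s≤s i<) = there (pad m i i<)
      go : ∀ w i → i < length w + suc (padding n) →
        ∃[ δ ] (δ ≤ 2 × (map (_, 0) w ++ pads) [ i ]= (nth w i , δ))
      go []      i       i<       = 1 , s≤s z≤n , pad _ i i<
      go (b ∷ w) zero    i<       = 0 , z≤n , here
      go (b ∷ w) (suc i) (s≤s i<) = let (δ , δ≤ , p) = go w i i< in δ , δ≤ , there p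

    padAt : (inputs₀ ++ pads) [ n ]= (false , 1)
    padAt = subst (λ i → (inputs₀ ++ pads) [ i ]= (false , 1))
      (trans (ℕ.+-identityʳ _) (List.length-map _ w)) ([]=-++ʳ inputs₀ here)

    base-Base : Base base
    base-Base = record
      { zeroAt  = []=-++ˡ _ padAt
      ; oneAt   = subst (λ i → base [ i ]= (true , 2)) (trans (ℕ.+-identityʳ _) length-pads)
                    ([]=-++ʳ (inputs₀ ++ pads) here)
      ; inputAt = λ i i< → let (δ , δ≤ , p) = padded i i< in δ , δ≤ , []=-++ˡ _ p }

    result : Evaluated φ (n ∷ []) base (start n)
    result = evaluate φ (sym length-base) base-Base (ℕ.≤-refl ∷ []) ℕ.≤-refl
    open Evaluated result public

    pad-steps : ∀ m vs → Steps vs (replicate m (MAJ [])) (vs ++ replicate m (false , 1))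
    pad-steps zero    vs = subst (Steps vs []) (sym (List.++-identityʳ vs)) []
    pad-steps (suc m) vs = MAJ [] ∷
      subst (Steps (vs ++ [ false , 1 ]) _) (List.++-assoc vs _ _) (pad-steps m (vs ++ [ false , 1 ]))

    all-steps : Steps inputs₀ (MAJ [] ∷ gates n) (base ++ added)
    all-steps = Steps-++ (pad-steps (suc (padding n)) inputs₀) (NOT padAt ∷ steps)

    base-bounded : Bounded (rank φ) base
    base-bounded = All.++⁺ (All.++⁺ (All.map⁺ (All.universal (λ _ → z≤n) w))
        (All.replicate⁺ (suc (padding n)) (ℕ.≤-trans (s≤s z≤n) (2≤rank φ))))
      (2≤rank φ ∷ [])

  -- Whether wire numbers are in range depends on the length alone, so the run on the word of `n`
  -- zeros certifies it.
  valid : ∀ n → Valid n (MAJ [] ∷ gates n)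
  valid n = subst (λ k → Valid k (MAJ [] ∷ gates n)) (trans (List.length-map _ w) length-w)
    (Steps⇒Valid (subst (λ k → Steps inputs₀ (MAJ [] ∷ gates k) (base ++ added)) length-w all-steps))
    where
    w = replicate n false
    length-w = List.length-replicate n
    open Values w hiding (n)

  family : CircuitFamily
  family = record
    { width   = λ n → proj₁ (extend inputs (MAJ []) (gates n) (valid n))
    ; circuit = λ n → proj₂ (extend inputs (MAJ []) (gates n) (valid n)) }
  open CircuitFamily family

  describe-circuit : ∀ n → describe (circuit n) ≡ ⟪ circuitProgram ⟫ (n ∷ [])
  describe-circuit n = trans (describe-extend inputs (MAJ []) (gates n) (valid n)) (sym (describe-gates n))

  wires-circuit : ∀ w → wires (Vec.fromList w) (circuit (length w)) ≡ Values.base w ++ Values.added w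
  wires-circuit w = wires-extend (Vec.fromList w) inputs (valid (length w))
    (subst (λ ws → Steps ws (MAJ [] ∷ gates (length w)) (base ++ added)) (sym (inputWires w)) all-steps)
    where
    open Values w
    inputWires : ∀ w → Vec.toList (Vec.zip (Vec.fromList w) (Vec.replicate _ 0)) ≡ map (_, 0) w
    inputWires []      = refl
    inputWires (b ∷ w) = cong ((b , 0) ∷_) (inputWires w)

  -- The block of `φ` comes last and ends with its root, so the root is the output wire; `index`
  -- checks this by counting wires.
  accepts-⟦⟧ : ∀ w → accepts w ≡ ⟦ φ ⟧ w (length w ∷ [])
  accepts-⟦⟧ w = eval-≡ (Vec.fromList w) (circuit (length w))
    (subst₂ (λ vs i → vs [ i ]= (⟦ φ ⟧ w (n ∷ []) , rootDepth)) (sym (wires-circuit w)) index ([]=-++ʳ base rootAt))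
    where
    open Values w
    index : length base + value (before φ) (n ∷ []) ≡ width n
    index = ℕ.suc-injective (begin
      suc (length base + value (before φ) (n ∷ []))  ≡⟨ ℕ.+-suc (length base) _ ⟨
      length base + suc (value (before φ) (n ∷ []))  ≡⟨ cong (length base +_) (ℕ.+-comm 1 _) ⟩
      length base + value (blockSize φ) (n ∷ [])          ≡⟨ cong (length base +_) length-≡ ⟨
      length base + length added                     ≡⟨ List.length-++ base ⟨
      length (base ++ added)                         ≡⟨ cong length (wires-circuit w) ⟨
      length (wires (Vec.fromList w) (circuit n))    ≡⟨ Vec.length-toList
          (Vec.zip (evalWires (circuit n) (Vec.fromList w)) (wireDepths (circuit n))) ⟩
      suc (width n)                                  ∎)
      where open ≡-Reasoning

  constantDepth : ConstantDepth
  constantDepth = rank φ , λ n →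
    let w = replicate n false in
    subst (λ k → depth (circuit k) ≤ rank φ) (List.length-replicate n)
      (depth≤ (Vec.fromList w) (circuit (length w))
        (subst (Bounded (rank φ)) (sym (wires-circuit w))
          (All.++⁺ (Values.base-bounded w) (Values.bounded w))))

  polynomialSize : PolynomialSize
  polynomialSize = let (c , e , bound) = length-polynomial circuitProgram in
    c , e , λ n → ℕ.≤-trans (circuitSize≤ (circuit n))
      (subst (λ out → length out ≤ c * n ^ e + c) (sym (describe-circuit n)) (bound n))

  logspaceUniform : LogspaceUniform
  logspaceUniform = let (M , computes) = program-logspace circuitProgram in
    M , LogspaceComputes-cong M (λ w → sym (describe-circuit (length w))) computes

does-true⁻ : {P : Set} (P? : Dec P) → does P? ≡ true → P
does-true⁻ (yes p) _ = p

-- Counting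

module _ {f : ℕ → Bool} where

  count-≤ : ∀ n → count f n ≤ n
  count-≤ zero    = z≤n
  count-≤ (suc n) with f n
  ... | true  = s≤s (count-≤ n)
  ... | false = ℕ.m≤n⇒m≤1+n (count-≤ n)

  count-mono : ∀ {m n} → m ≤ n → count f m ≤ count f n
  count-mono {n = zero}  z≤n = z≤n
  count-mono {n = suc n} m≤  with ℕ.m≤n⇒m<n∨m≡n m≤
  ... | inj₁ m<   = ℕ.≤-trans (count-mono (ℕ.≤-pred m<)) (ℕ.m≤n+m _ _)
  ... | inj₂ refl = ℕ.≤-refl

  -- The witness is the largest counted number below n.
  count-suc⁻ : ∀ {k} n → suc k ≤ count f n → ∃[ i ] (i < n × f i ≡ true × k ≤ count f i)
  count-suc⁻ (suc n) k< with f n in eq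
  ... | true  = n , ℕ.≤-refl , eq , ℕ.≤-pred k<
  ... | false = let (i , i< , fi , k≤) = count-suc⁻ n k< in i , ℕ.m≤n⇒m≤1+n i< , fi , k≤

  count-suc⁺ : ∀ {k n i} → i < n → f i ≡ true → k ≤ count f i → suc k ≤ count f n
  count-suc⁺ {i = i} i<n fi k≤ = ℕ.≤-trans (subst (λ b → _ ≤ bit b + count f i) (sym fi) (s≤s k≤)) (count-mono i<n)

  count-all⁻ : ∀ n → n ≤ count f n → ∀ i → i < n → f i ≡ true
  count-all⁻ (suc n) n≤ i i< with f n in eq
  ... | false = ⊥-elim (ℕ.<-irrefl refl (ℕ.≤-trans n≤ (count-≤ n)))
  ... | true  with ℕ.m≤n⇒m<n∨m≡n (ℕ.≤-pred i<)
  ...   | inj₁ i<n  = count-all⁻ n (ℕ.≤-pred n≤) i i<n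
  ...   | inj₂ refl = eq

  count-all⁺ : ∀ n → (∀ i → i < n → f i ≡ true) → n ≤ count f n
  count-all⁺ zero    _   = z≤n
  count-all⁺ (suc n) all rewrite all n ℕ.≤-refl = s≤s (count-all⁺ n (λ i i< → all i (ℕ.m≤n⇒m≤1+n i<)))

count-cong : ∀ {f g} → (∀ i → f i ≡ g i) → ∀ n → count f n ≡ count g n
count-cong f≗g zero    = refl
count-cong f≗g (suc n) = cong₂ (λ b k → bit b + k) (f≗g n) (count-cong f≗g n)

count-front : ∀ f n → count f (suc n) ≡ bit (f 0) + count (f ∘ suc) n
count-front f zero    = refl
count-front f (suc n) = trans (cong (bit (f (suc n)) +_) (count-front f n))
  (swap (bit (f (suc n))) (bit (f 0)) _)
  where
  swap : ∀ a b c → a + (b + c) ≡ b + (a + c)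
  swap = solve-∀

-- Quantifiers

exists forAll : ∀ {d} → Fin d → Formula (suc d) → Formula d
exists y φ = atLeast (lit 1) y φ
forAll y φ = atLeast (var y) y φ

module _ {d : ℕ} (y : Fin d) (φ : Formula (suc d)) {w : List Bool} {env : Vec ℕ d} where

  exists⁻ : ⟦ exists y φ ⟧ w env ≡ true → ∃[ i ] (i < lookup env y × ⟦ φ ⟧ w (i ∷ env) ≡ true)
  exists⁻ t = let (i , i< , φi , _) = count-suc⁻ (lookup env y) (does-true⁻ (1 ℕ.≤? _) t) in i , i< , φi

  exists⁺ : ∀ i → i < lookup env y → ⟦ φ ⟧ w (i ∷ env) ≡ true → ⟦ exists y φ ⟧ w env ≡ true
  exists⁺ i i< φi = dec-true (1 ℕ.≤? _) (count-suc⁺ i< φi z≤n)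

  forAll⁻ : ⟦ forAll y φ ⟧ w env ≡ true → ∀ i → i < lookup env y → ⟦ φ ⟧ w (i ∷ env) ≡ true
  forAll⁻ t = count-all⁻ (lookup env y) (does-true⁻ (lookup env y ℕ.≤? _) t)

  forAll⁺ : (∀ i → i < lookup env y → ⟦ φ ⟧ w (i ∷ env) ≡ true) → ⟦ forAll y φ ⟧ w env ≡ true
  forAll⁺ all = dec-true (lookup env y ℕ.≤? _) (count-all⁺ (lookup env y) all)

∧-true⁺ : ∀ {a b} → a ≡ true → b ≡ true → a ∧ b ≡ true
∧-true⁺ refl refl = refl

-- Reading the header of an encoded instance

nth-++ : ∀ xs {ys} i → nth (xs ++ ys) (length xs + i) ≡ nth ys i
nth-++ []       i = refl
nth-++ (x ∷ xs) i = nth-++ xs i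

nth-unary : ∀ m {ys} i → nth (unary m ++ ys) (suc m + i) ≡ nth ys i
nth-unary zero    i = refl
nth-unary (suc m) i = nth-unary m i

nth-unary-true : ∀ m {ys i} → i < m → nth (unary m ++ ys) i ≡ true
nth-unary-true (suc m) {i = zero}  _        = refl
nth-unary-true (suc m) {i = suc i} (s≤s i<) = nth-unary-true m i<

nth-unary-false : ∀ m {ys} → nth (unary m ++ ys) m ≡ false
nth-unary-false zero    = refl
nth-unary-false (suc m) = nth-unary-false m

offset : ∀ {d} → List (Fin d) → Polynomial d → Polynomial d
offset []       e = e
offset (y ∷ ys) e = lit 1 ⊕ var y ⊕ offset ys e

unaryAt : ∀ {d} → List (Fin d) → Fin d → Formula d
unaryAt ys y = forAll y (bitAt (offset (map suc ys) (var zero))) & neg (bitAt (offset ys (var y)))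

unaries : List ℕ → List Bool → List Bool
unaries []       r = r
unaries (m ∷ ms) r = unary m ++ unaries ms r

nth-offset : ∀ {d} (ys : List (Fin d)) e (env : Vec ℕ d) r →
  nth (unaries (map (lookup env) ys) r) (value (offset ys e) env) ≡ nth r (value e env)
nth-offset []       e env r = refl
nth-offset (y ∷ ys) e env r = trans (nth-unary (lookup env y) _) (nth-offset ys e env r)

nth-offset-suc : ∀ {d} (ys : List (Fin d)) i (env : Vec ℕ d) r →
  nth (unaries (map (lookup env) ys) r) (value (offset (map suc ys) (var zero)) (i ∷ env)) ≡ nth r i
nth-offset-suc []       i env r = refl
nth-offset-suc (y ∷ ys) i env r = trans (nth-unary (lookup env y) _) (nth-offset-suc ys i env r)

module _ {d : ℕ} (ys : List (Fin d)) (y : Fin d) (env : Vec ℕ d) (m : ℕ) (r : List Bool) where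

  private
    w : List Bool
    w = unaries (map (lookup env) ys) (unary m ++ r)
    φ : Formula (suc d)
    φ = bitAt (offset (map suc ys) (var zero))

  -- A guess that is too small meets a 1 where the terminating 0 should be; a guess that is too
  -- large has that 0 among its supposed ones.
  unaryAt⁻ : ⟦ unaryAt ys y ⟧ w env ≡ true → lookup env y ≡ m
  unaryAt⁻ t with ℕ.<-cmp (lookup env y) m
  ... | tri≈ _ eq _ = eq
  ... | tri< lt _ _ with () ← trans (sym (nth-unary-true m {r} lt))
          (trans (sym (nth-offset ys (var y) env (unary m ++ r)))
            (Bool.not-injective (Bool.∧-conicalʳ (⟦ forAll y φ ⟧ w env) _ t)))
  ... | tri> _ _ gt with () ← trans (sym (nth-unary-false m {r}))
          (trans (sym (nth-offset-suc ys m env (unary m ++ r)))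
            (forAll⁻ y φ {w} {env} (Bool.∧-conicalˡ _ _ t) m gt))

  unaryAt⁺ : lookup env y ≡ m → ⟦ unaryAt ys y ⟧ w env ≡ true
  unaryAt⁺ refl = ∧-true⁺
    (forAll⁺ y φ {w} {env} (λ i i< → trans (nth-offset-suc ys i env (unary m ++ r)) (nth-unary-true m i<)))
    (cong not (trans (nth-offset ys (var y) env (unary m ++ r)) (nth-unary-false m)))

-- Searching for rows

-- `js` is `is` with `q` new numbers put in front, the first below `b` and each further one below
-- its predecessor; hence the new numbers are distinct.
data Descending : ℕ → ℕ → List ℕ → List ℕ → Set where
  done : ∀ {b is} → Descending 0 b is is
  pick : ∀ {q b is js i} → i < b → Descending q i (i ∷ is) js → Descending (suc q) b is js

module _ (X : ℕ → ℕ → Bool) (m n k : ℕ) where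

  common : List ℕ → ℕ → Bool
  -- This excludes a column of ones, whose condition would make a rule trivial.
  common []       j = not (does (m ℕ.≤? count (λ i → X i j) m))
  common (i ∷ is) j = X i j ∧ common is j

  search : ℕ → ℕ → List ℕ → Bool
  search zero    b is = does (k ℕ.≤? count (common is) n) ∧ does (2 ℕ.≤? count (common is) n)
  search (suc q) b is = does (1 ℕ.≤? count (λ i → search q i (i ∷ is)) b)

  search⁻ : ∀ q {b is} → search q b is ≡ true →
    ∃[ js ] (Descending q b is js × k ≤ count (common js) n × 2 ≤ count (common js) n)
  search⁻ zero {is = is} t = is , done ,
    does-true⁻ (k ℕ.≤? _) (Bool.∧-conicalˡ _ _ t) ,
    does-true⁻ (2 ℕ.≤? _) (Bool.∧-conicalʳ (does (k ℕ.≤? count (common is) n)) _ t)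
  search⁻ (suc q) {b} t =
    let (i , i< , t′ , _) = count-suc⁻ b (does-true⁻ (1 ℕ.≤? _) t)
        (js , js↓ , bounds) = search⁻ q t′
    in js , pick i< js↓ , bounds

  search⁺ : ∀ {q b is js} → Descending q b is js → k ≤ count (common js) n →
    2 ≤ count (common js) n → search q b is ≡ true
  search⁺ done         k≤ 2≤ = ∧-true⁺ (dec-true (k ℕ.≤? _) k≤) (dec-true (2 ℕ.≤? _) 2≤)
  search⁺ (pick i< js) k≤ 2≤ = dec-true (1 ℕ.≤? _) (count-suc⁺ i< (search⁺ js k≤ 2≤) z≤n)

module _ {d : ℕ} (m n k : Fin d) where

  entry : Fin d → Fin d → Formula d
  entry i j = bitAt (offset (m ∷ n ∷ k ∷ []) (var i ⊗ var n ⊕ var j))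

commonFormula : ∀ {d} → Fin d → Fin d → Fin d → Fin d → List (Fin d) → Formula d
commonFormula m n k j []       = neg (forAll m (entry (suc m) (suc n) (suc k) zero (suc j)))
commonFormula m n k j (i ∷ is) = entry m n k i j & commonFormula m n k j is

searchFormula : ∀ {d} → ℕ → (m n k b : Fin d) → List (Fin d) → Formula d
searchFormula zero    m n k b is =
  atLeast (var k) n (commonFormula (suc m) (suc n) (suc k) zero (map suc is)) &
  atLeast (lit 2) n (commonFormula (suc m) (suc n) (suc k) zero (map suc is))
searchFormula (suc q) m n k b is =
  -- The row just guessed becomes the bound of the next quantifier, which forces the descent.
  exists b (searchFormula q (suc m) (suc n) (suc k) zero (zero ∷ map suc is))

-- The variables k, n, m and the input length have the indices 0, 1, 2 and 3.
decodedFormula : ℕ → Formula 4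
decodedFormula p = unaryAt [] m & unaryAt (m ∷ []) n & unaryAt (m ∷ n ∷ []) k & searchFormula p m n k m []
  where
  m n k : Fin 4
  m = suc (suc zero)
  n = suc zero
  k = zero

problemFormula : ℕ → Formula 1
-- All three guesses are bounded by the input length, whose index grows by one with each new
-- variable.
problemFormula p = exists zero (exists (suc zero) (exists (suc (suc zero)) (decodedFormula p)))

module _ (body : List Bool) (m n k : ℕ) where

  entryAt : ℕ → ℕ → Bool
  entryAt i j = nth body (i * n + j)

  word : List Bool
  word = unary m ++ unary n ++ unary k ++ body

  ⟦entry⟧ : ∀ {d} (mᵛ nᵛ kᵛ i j : Fin d) env → lookup env mᵛ ≡ m → lookup env nᵛ ≡ n → lookup env kᵛ ≡ k →
    ⟦ entry mᵛ nᵛ kᵛ i j ⟧ word env ≡ entryAt (lookup env i) (lookup env j)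
  ⟦entry⟧ mᵛ nᵛ kᵛ i j env refl refl refl = nth-offset (mᵛ ∷ nᵛ ∷ kᵛ ∷ []) (var i ⊗ var nᵛ ⊕ var j) env body

  ⟦commonFormula⟧ : ∀ {d} (mᵛ nᵛ kᵛ j : Fin d) is env →
    lookup env mᵛ ≡ m → lookup env nᵛ ≡ n → lookup env kᵛ ≡ k →
    ⟦ commonFormula mᵛ nᵛ kᵛ j is ⟧ word env ≡ common entryAt m n k (map (lookup env) is) (lookup env j)
  ⟦commonFormula⟧ mᵛ nᵛ kᵛ j [] env m≡ n≡ k≡ = cong₂ (λ a b → not (does (a ℕ.≤? b))) m≡
    (trans (cong (count _) m≡)
      (count-cong (λ i → ⟦entry⟧ (suc mᵛ) (suc nᵛ) (suc kᵛ) zero (suc j) (i ∷ env) m≡ n≡ k≡) m))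
  ⟦commonFormula⟧ mᵛ nᵛ kᵛ j (i ∷ is) env m≡ n≡ k≡ =
    cong₂ _∧_ (⟦entry⟧ mᵛ nᵛ kᵛ i j env m≡ n≡ k≡) (⟦commonFormula⟧ mᵛ nᵛ kᵛ j is env m≡ n≡ k≡)

  map-lookup-suc : ∀ {d} (is : List (Fin d)) (env : Vec ℕ d) i →
    map (lookup (i ∷ env)) (map suc is) ≡ map (lookup env) is
  map-lookup-suc is env i = sym (List.map-∘ is)

  ⟦searchFormula⟧ : ∀ {d} q (mᵛ nᵛ kᵛ b : Fin d) is env →
    lookup env mᵛ ≡ m → lookup env nᵛ ≡ n → lookup env kᵛ ≡ k →
    ⟦ searchFormula q mᵛ nᵛ kᵛ b is ⟧ word env ≡ search entryAt m n k q (lookup env b) (map (lookup env) is)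
  ⟦searchFormula⟧ zero mᵛ nᵛ kᵛ b is env m≡ n≡ k≡ =
    cong₂ (λ c a → does (c ℕ.≤? a) ∧ does (2 ℕ.≤? a)) k≡
      (trans (cong (count _) n≡) (count-cong (λ j →
        trans (⟦commonFormula⟧ (suc mᵛ) (suc nᵛ) (suc kᵛ) zero (map suc is) (j ∷ env) m≡ n≡ k≡)
          (cong (λ is → common entryAt m n k is j) (map-lookup-suc is env j))) n))
  ⟦searchFormula⟧ (suc q) mᵛ nᵛ kᵛ b is env m≡ n≡ k≡ =
    cong (λ a → does (1 ℕ.≤? a)) (count-cong (λ i →
      trans (⟦searchFormula⟧ q (suc mᵛ) (suc nᵛ) (suc kᵛ) zero (zero ∷ map suc is) (i ∷ env) m≡ n≡ k≡)
        (cong (λ is → search entryAt m n k q i (i ∷ is)) (map-lookup-suc is env i))) (lookup env b))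

  length-word : length word ≡ suc m + (suc n + (suc k + length body))
  length-word = trans (prefix m _) (cong (suc m +_) (trans (prefix n _) (cong (suc n +_) (prefix k body))))
    where
    prefix : ∀ m ys → length (unary m ++ ys) ≡ suc m + length ys
    prefix zero    ys = refl
    prefix (suc m) ys = cong suc (prefix m ys)

  -- The unary checks refute all wrong guesses. The right ones are below the input length, since the
  -- unary code of a number is longer than the number.
  decode-⇔ : ∀ p → ⟦ problemFormula p ⟧ word (length word ∷ []) ≡ true ⇔ search entryAt m n k p m [] ≡ true
  decode-⇔ p = mk⇔ forwards backwards
    where
    N : ℕ
    N = length word
    φ₃ = decodedFormula p
    φ₂ = exists (suc (suc zero)) φ₃
    φ₁ = exists (suc zero) φ₂

    ⟦search⟧ : ⟦ searchFormula p (suc (suc zero)) (suc zero) zero (suc (suc zero)) [] ⟧ word (k ∷ n ∷ m ∷ N ∷ [])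
               ≡ search entryAt m n k p m []
    ⟦search⟧ = ⟦searchFormula⟧ p (suc (suc zero)) (suc zero) zero (suc (suc zero)) []
      (k ∷ n ∷ m ∷ N ∷ []) refl refl refl

    decoded⁻ : ∀ m′ n′ k′ → ⟦ φ₃ ⟧ word (k′ ∷ n′ ∷ m′ ∷ N ∷ []) ≡ true → search entryAt m n k p m [] ≡ true
    decoded⁻ m′ n′ k′ t
      -- The order matters: a check finds its place in the word only after the earlier guesses are
      -- known to be right.
      with unaryAt⁻ [] (suc (suc zero)) (k′ ∷ n′ ∷ m′ ∷ N ∷ []) m _ (Bool.∧-conicalˡ _ _ t)
    ... | refl
      with Bool.∧-conicalʳ (⟦ unaryAt [] (suc (suc zero)) ⟧ word (k′ ∷ n′ ∷ m′ ∷ N ∷ [])) _ t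
    ... | t₁
      with unaryAt⁻ (suc (suc zero) ∷ []) (suc zero) (k′ ∷ n′ ∷ m ∷ N ∷ []) n _ (Bool.∧-conicalˡ _ _ t₁)
    ... | refl
      with Bool.∧-conicalʳ (⟦ unaryAt (suc (suc zero) ∷ []) (suc zero) ⟧ word (k′ ∷ n ∷ m ∷ N ∷ [])) _ t₁
    ... | t₂
      with unaryAt⁻ (suc (suc zero) ∷ suc zero ∷ []) zero (k′ ∷ n ∷ m ∷ N ∷ []) k _ (Bool.∧-conicalˡ _ _ t₂)
    ... | refl = trans (sym ⟦search⟧)
      (Bool.∧-conicalʳ (⟦ unaryAt (suc (suc zero) ∷ suc zero ∷ []) zero ⟧ word (k ∷ n ∷ m ∷ N ∷ [])) _ t₂)

    forwards : ⟦ problemFormula p ⟧ word (N ∷ []) ≡ true → search entryAt m n k p m [] ≡ true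
    forwards t =
      let (m′ , _ , t₁) = exists⁻ zero φ₁ {word} {N ∷ []} t
          (n′ , _ , t₂) = exists⁻ (suc zero) φ₂ {word} {m′ ∷ N ∷ []} t₁
          (k′ , _ , t₃) = exists⁻ (suc (suc zero)) φ₃ {word} {n′ ∷ m′ ∷ N ∷ []} t₂
      in decoded⁻ m′ n′ k′ t₃

    decoded⁺ : search entryAt m n k p m [] ≡ true → ⟦ φ₃ ⟧ word (k ∷ n ∷ m ∷ N ∷ []) ≡ true
    decoded⁺ t = ∧-true⁺ (unaryAt⁺ [] (suc (suc zero)) (k ∷ n ∷ m ∷ N ∷ []) m _ refl)
      (∧-true⁺ (unaryAt⁺ (suc (suc zero) ∷ []) (suc zero) (k ∷ n ∷ m ∷ N ∷ []) n _ refl)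
      (∧-true⁺ (unaryAt⁺ (suc (suc zero) ∷ suc zero ∷ []) zero (k ∷ n ∷ m ∷ N ∷ []) k _ refl)
        (trans ⟦search⟧ t)))

    backwards : search entryAt m n k p m [] ≡ true → ⟦ problemFormula p ⟧ word (N ∷ []) ≡ true
    backwards t = exists⁺ zero φ₁ {word} {N ∷ []} m m<N
      (exists⁺ (suc zero) φ₂ {word} {m ∷ N ∷ []} n n<N
        (exists⁺ (suc (suc zero)) φ₃ {word} {n ∷ m ∷ N ∷ []} k k<N (decoded⁺ t)))
      where
      m<N : m < N
      m<N = subst (m <_) (sym length-word) (s≤s (ℕ.m≤m+n m _))
      n<N : n < N
      n<N = subst (n <_) (sym length-word) (ℕ.≤-trans (s≤s (ℕ.m≤m+n n _)) (ℕ.m≤n+m _ (suc m)))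
      k<N : k < N
      k<N = subst (k <_) (sym length-word) (ℕ.≤-trans (ℕ.≤-trans (s≤s (ℕ.m≤m+n k (length body))) (ℕ.m≤n+m _ (suc n)))
        (ℕ.m≤n+m _ (suc m)))

Descending-< : ∀ {q b is js m} → Descending q b is js → b ≤ m →
  All (_< m) is → All (_< m) js
Descending-< done          b≤m is< = is<
Descending-< (pick i< js↓) b≤m is< =
  Descending-< js↓ (ℕ.≤-trans (ℕ.<⇒≤ i<) b≤m) (ℕ.<-≤-trans i< b≤m ∷ is<)

module _ {f : ℕ → Bool} where

  -- Only the final list is known to satisfy `f`; the second component hands this back to the number
  -- picked at the current stage.
  Descending⇒count : ∀ {q b is js} → Descending q b is js → All (λ i → f i ≡ true) js →
    q ≤ count f b × All (λ i → f i ≡ true) is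
  Descending⇒count done          fs = z≤n , fs
  Descending⇒count (pick i< js↓) fs with Descending⇒count js↓ fs
  ... | q≤ , fi ∷ fis = count-suc⁺ i< fi q≤ , fis

  -- Picking the largest counted number each time lowers the remaining count by only one.
  count⇒Descending : ∀ q b {is} → q ≤ count f b → All (λ i → f i ≡ true) is →
    ∃[ js ] (Descending q b is js × All (λ i → f i ≡ true) js)
  count⇒Descending zero    b q≤ fis = _ , done , fis
  count⇒Descending (suc q) b q< fis =
    let (i , i< , fi , q≤) = count-suc⁻ b q<
        (js , js↓ , fjs) = count⇒Descending q i q≤ (fi ∷ fis)
    in js , pick i< js↓ , fjs

module _ (X : ℕ → ℕ → Bool) (m n k : ℕ) where

  common⁻ : ∀ is {j} → common X m n k is j ≡ true →
    All (λ i → X i j ≡ true) is × ¬ (∀ i → i < m → X i j ≡ true)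
  common⁻ [] {j} t = [] , λ all →
    case trans (sym (cong not t)) (trans (Bool.not-involutive _) (dec-true (m ℕ.≤? _) (count-all⁺ m all))) of λ ()
  common⁻ (i ∷ is) {j} t =
    let (xs , ¬all) = common⁻ is (Bool.∧-conicalʳ (X i j) _ t) in Bool.∧-conicalˡ _ _ t ∷ xs , ¬all

  common⁺ : ∀ {is j} → All (λ i → X i j ≡ true) is → ¬ (∀ i → i < m → X i j ≡ true) →
    common X m n k is j ≡ true
  common⁺ [] ¬all = cong not (dec-false (m ℕ.≤? _) (λ m≤ → ¬all (count-all⁻ m m≤)))
  common⁺ (x ∷ xs) ¬all = ∧-true⁺ x (common⁺ xs ¬all)

-- Lists as functions of positions

module _ {A : Set} {P : A → Set} (P? : Decidable P) where

  holdsAt : List A → ℕ → Bool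
  holdsAt []       _       = false
  holdsAt (x ∷ xs) zero    = does (P? x)
  holdsAt (x ∷ xs) (suc i) = holdsAt xs i

  count-holdsAt : ∀ xs → count (holdsAt xs) (length xs) ≡ length (filter P? xs)
  count-holdsAt []       = refl
  count-holdsAt (x ∷ xs) = trans (count-front (holdsAt (x ∷ xs)) (length xs))
    (trans (cong (bit (does (P? x)) +_) (count-holdsAt xs)) head)
    where
    head : bit (does (P? x)) + length (filter P? xs) ≡ length (filter P? (x ∷ xs))
    head with does (P? x)
    ... | true  = refl
    ... | false = refl

  holdsAt-lookup : ∀ xs (i : Fin (length xs)) → holdsAt xs (toℕ i) ≡ does (P? (List.lookup xs i))
  holdsAt-lookup (x ∷ xs) zero    = refl
  holdsAt-lookup (x ∷ xs) (suc i) = holdsAt-lookup xs i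

  holdsAt⁻ : ∀ xs i → holdsAt xs i ≡ true → ∃[ i′ ] (i ≡ toℕ {length xs} i′ × P (List.lookup xs i′))
  holdsAt⁻ (x ∷ xs) zero    t = zero , refl , does-true⁻ (P? x) t
  holdsAt⁻ (x ∷ xs) (suc i) t = let (i′ , i≡ , p) = holdsAt⁻ xs i t in suc i′ , cong suc i≡ , p

count-filter-tabulate : ∀ {n} {A : Set} (f : A → Bool) (g : Fin n → A) (h : ℕ → Bool) →
  (∀ i → f (g i) ≡ h (toℕ i)) → length (filter (λ x → f x Bool.≟ true) (tabulate g)) ≡ count h n
count-filter-tabulate {zero}  f g h eq = refl
count-filter-tabulate {suc n} f g h eq = trans head (sym (count-front h n))
  where
  tail : length (filter (λ x → f x Bool.≟ true) (tabulate (g ∘ suc))) ≡ count (h ∘ suc) n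
  tail = count-filter-tabulate f (g ∘ suc) (h ∘ suc) (eq ∘ suc)
  head : length (filter (λ x → f x Bool.≟ true) (tabulate g)) ≡ bit (h 0) + count (h ∘ suc) n
  head rewrite sym (eq zero) with f (g zero)
  ... | true  = cong suc tail
  ... | false = tail

Unique-lookup : {A : Set} {xs : List A} → Unique xs → ∀ i j → List.lookup xs i ≡ List.lookup xs j → i ≡ j
Unique-lookup (_ ∷ u)  zero    zero    eq = refl
Unique-lookup (x∉ ∷ u) zero    (suc j) eq = ⊥-elim (All.lookup x∉ (∈-lookup j) eq)
Unique-lookup (x∉ ∷ u) (suc i) zero    eq = ⊥-elim (All.lookup x∉ (∈-lookup i) (sym eq))
Unique-lookup (_ ∷ u)  (suc i) (suc j) eq = cong suc (Unique-lookup u i j eq)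

-- Sending a position in `xs` to a position of the same element in `ys` is injective.
Unique⇒length≤ : {A : Set} {xs ys : List A} → Unique xs → All (_∈ ys) xs → length xs ≤ length ys
Unique⇒length≤ {xs = xs} {ys} u xs⊆ys = Fin.injective⇒≤ {f = λ i → Any.index (at i)} injective
  where
  at : ∀ i → List.lookup xs i ∈ ys
  at i = All.lookup xs⊆ys (∈-lookup i)
  injective : ∀ {i j} → Any.index (at i) ≡ Any.index (at j) → i ≡ j
  injective {i} {j} eq = Unique-lookup u i j
    (trans (Any.lookup-index (at i)) (trans (cong (List.lookup ys) eq) (sym (Any.lookup-index (at j)))))

module _ {n : ℕ} (good : ℕ → Bool) where

  goodFins : List (Fin n)
  goodFins = filter (λ j → good (toℕ j) Bool.≟ true) (allFin n)

  length-goodFins : length goodFins ≡ count good n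
  length-goodFins = count-filter-tabulate {n} (good ∘ toℕ) (λ j → j) good (λ _ → refl)

  Unique⇒≤count : ∀ {js} → Unique js → All (λ j → good (toℕ j) ≡ true) js → length js ≤ count good n
  Unique⇒≤count {js} u goods = subst (length js ≤_) length-goodFins
    (Unique⇒length≤ u (All.map (λ g → ∈-filter⁺ (λ (j : Fin n) → good (toℕ j) Bool.≟ true) (∈-allFin _) g) goods))

-- Conditions on Boolean attributes

module _ (A : Attribute) (boolean : Boolean A) where

  -- A Boolean attribute has one non-null value, so a relation cannot distinguish between values.
  fulfils-all : ∀ {r v} → Fulfils A r v → ∀ v′ → Fulfils A r v′
  fulfils-all {r} {v} fv v′ = subst (Fulfils A r) (trans (proj₂ boolean v) (sym (proj₂ boolean v′))) fv

nonNull : (A : Attribute) → Boolean A → Relation A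
nonNull (categorical _ _)   (c , _) = equal c
nonNull (numeric _ value _) (c , _) = inside (value c) (value c) ℚ.≤-refl

fulfils-nonNull : (A : Attribute) (boolean : Boolean A) (v : Value A) → Fulfils A (nonNull A boolean) v
fulfils-nonNull (categorical _ _)   (c , eq) v = eq v
fulfils-nonNull (numeric _ value _) (c , eq) v =
  ℚ.≤-reflexive (cong value (sym (eq v))) , ℚ.≤-reflexive (cong value (eq v))

Any⇒is-just : ∀ {A : Set} {P : A → Set} {d : Maybe A} → Maybe.Any P d → is-just d ≡ true
Any⇒is-just (Maybe.just _) = refl

is-just⇒Any : ∀ {A : Set} {P : A → Set} {d : Maybe A} → (∀ v → P v) → is-just d ≡ true → Maybe.Any P d
is-just⇒Any {d = just v} p _ = Maybe.just (p v)

filter-≡⁻ : ∀ {A : Set} {P : A → Set} (P? : Decidable P) (xs : List A) → filter P? xs ≡ xs → All P xs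
filter-≡⁻ {P = P} P? xs eq = subst (All P) eq (All.all-filter P? xs)

nth-row : ∀ {n} (I : AttributeSet n) T (rest : List Bool) (i : Fin (length T)) (j : Fin n) →
  nth (concatMap (row I) T ++ rest) (toℕ i * n + toℕ j) ≡ is-just (List.lookup T i j)
nth-row {n} I (t ∷ T) rest zero j = trans
  (cong (λ bs → nth bs (toℕ j)) (List.++-assoc (row I t) _ rest)) (go (λ j → is-just (t j)) j)
  where
  go : ∀ {n ys} (f : Fin n → Bool) (j : Fin n) → nth (tabulate f ++ ys) (toℕ j) ≡ f j
  go f zero    = refl
  go f (suc j) = go (f ∘ suc) j
nth-row {n} I (t ∷ T) rest (suc i) j = begin
  nth ((row I t ++ concatMap (row I) T) ++ rest) (n + toℕ i * n + toℕ j)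
    ≡⟨ cong₂ nth (List.++-assoc (row I t) _ rest)
         (trans (ℕ.+-assoc n _ _) (cong (_+ (toℕ i * n + toℕ j)) (sym (List.length-tabulate (λ j → is-just (t j)))))) ⟩
  nth (row I t ++ (concatMap (row I) T ++ rest)) (length (row I t) + (toℕ i * n + toℕ j))
    ≡⟨ nth-++ (row I t) _ ⟩
  nth (concatMap (row I) T ++ rest) (toℕ i * n + toℕ j)
    ≡⟨ nth-row I T rest i j ⟩
  is-just (List.lookup T i j) ∎
  where open ≡-Reasoning

-- Ceilings and the support threshold.

floor-*≤ : ∀ q → ℚ.⌊ q ⌋ ℤ.* ↧ q ℤ.≤ ↥ q
floor-*≤ q@record{} = ℤ.[n/d]*d≤n (↥ q) (↧ q)

<suc-floor : ∀ q → ↥ q ℤ.< ℤ.suc ℚ.⌊ q ⌋ ℤ.* ↧ q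
<suc-floor q@record{} = subst (λ z → ↥ q ℤ.< ℤ.suc z ℤ.* ↧ q)
  (sym (ℤ.div-pos-is-/ℕ (↥ q) (↧ₙ q))) (ℤ.n<s[n/ℕd]*d (↥ q) (↧ₙ q))

-- The ceiling is `- ⌊ - q ⌋`, so the two directions are the two bounds on the floor of `- q`; the
-- strict one is sharpened by passing to an integer predecessor.
ceiling-≤-⇔ : ∀ q a → ℚ.⌈ q ⌉ ℤ.≤ a ⇔ ↥ q ℤ.≤ a ℤ.* ↧ q
ceiling-≤-⇔ q@record{} a = mk⇔ forwards backwards
  where
  f = ℚ.⌊ ℚ.- q ⌋
  forwards : ℚ.⌈ q ⌉ ℤ.≤ a → ↥ q ℤ.≤ a ℤ.* ↧ q
  forwards ⌈q⌉≤a = begin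
    ↥ q                 ≡⟨ ℤ.neg-involutive (↥ q) ⟨
    ℤ.- (ℤ.- ↥ q)       ≤⟨ ℤ.neg-mono-≤ (subst₂ (λ d n → f ℤ.* d ℤ.≤ n) (ℚ.↧-neg q) (ℚ.↥-neg q) (floor-*≤ (ℚ.- q))) ⟩
    ℤ.- (f ℤ.* ↧ q)     ≡⟨ ℤ.neg-distribˡ-* f (↧ q) ⟩
    (ℤ.- f) ℤ.* ↧ q     ≤⟨ ℤ.*-monoʳ-≤-nonNeg (↧ q) ⌈q⌉≤a ⟩
    a ℤ.* ↧ q           ∎
    where open ℤ.≤-Reasoning
  backwards : ↥ q ℤ.≤ a ℤ.* ↧ q → ℚ.⌈ q ⌉ ℤ.≤ a
  backwards q≤a = subst (ℤ.- f ℤ.≤_) (ℤ.neg-involutive a) (ℤ.neg-mono-≤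
    (subst (ℤ.- a ℤ.≤_) (ℤ.pred-suc f) (ℤ.i<j⇒i≤pred[j] {j = ℤ.suc f} (ℤ.*-cancelʳ-<-nonNeg (↧ q) (begin-strict
      (ℤ.- a) ℤ.* ↧ q   ≡⟨ ℤ.neg-distribˡ-* a (↧ q) ⟨
      ℤ.- (a ℤ.* ↧ q)   ≤⟨ ℤ.neg-mono-≤ q≤a ⟩
      ℤ.- ↥ q           <⟨ subst₂ (λ d n → n ℤ.< ℤ.suc f ℤ.* d) (ℚ.↧-neg q) (ℚ.↥-neg q) (<suc-floor (ℚ.- q)) ⟩
      ℤ.suc f ℤ.* ↧ q   ∎)))))
    where open ℤ.≤-Reasoning

cross-multiply : ∀ q s m → toℚᵘ q ℚᵘ.≃ toℚᵘ s ℚᵘ.* mkℚᵘ (pos m) 0 →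
  ↥ q ℤ.* ↧ s ≡ (↥ s ℤ.* pos m) ℤ.* ↧ q
cross-multiply q@record{} s@record{} m (*≡* eq) =
  trans (cong (↥ q ℤ.*_) (sym (ℤ.*-identityʳ (↧ s)))) eq

-- Both sides say that s m ≤ a, the right one because `a` is an integer. The product is stored in
-- lowest terms, so `cross-multiply` is needed to relate its fraction to that of `s`.
ratio-≥-⇔ : ∀ {s a m p} → ℚ.⌈ s ℚ.* (pos m ℚ./ 1) ⌉ ≡ pos p → 1 ℕ.≤ p → s ℚ.≤ ratio a m ⇔ p ℕ.≤ a
-- An empty database would give the threshold 0, against `1 ≤ p`.
ratio-≥-⇔ {s} {a} {zero} {p} ⌈⌉≡p 1≤p
  with () ← ℕ.≤-trans 1≤p (ℕ.≤-reflexive (ℤ.+-injective (sym (trans (cong ℚ.ceiling (sym (ℚ.*-zeroʳ s))) ⌈⌉≡p))))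
ratio-≥-⇔ {s@record{}} {a} {m@(suc b)} {p} ⌈⌉≡p 1≤p = mk⇔
  (λ s≤ → ℤ.drop‿+≤+ (subst (ℤ._≤ pos a) ⌈⌉≡p (Equivalence.from (ceiling-≤-⇔ q (pos a)) (to (cross⁻ s≤)))))
  (λ p≤a → cross⁺ (from (Equivalence.to (ceiling-≤-⇔ q (pos a)) (subst (ℤ._≤ pos a) (sym ⌈⌉≡p) (ℤ.+≤+ p≤a)))))
  where
  q = s ℚ.* (pos m ℚ./ 1)
  open ℤ.≤-Reasoning

  swap : ∀ x y z → (x ℤ.* y) ℤ.* z ≡ (x ℤ.* z) ℤ.* y
  swap = solveℤ-∀

  cross⁻ : s ℚ.≤ pos a ℚ./ m → ↥ s ℤ.* pos m ℤ.≤ pos a ℤ.* ↧ s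
  cross⁻ s≤ with ℚᵘ.≤-respʳ-≃ (ℚ.toℚᵘ-fromℚᵘ (mkℚᵘ (pos a) b)) (ℚ.toℚᵘ-mono-≤ s≤)
  ... | *≤* le = le
  cross⁺ : ↥ s ℤ.* pos m ℤ.≤ pos a ℤ.* ↧ s → s ℚ.≤ pos a ℚ./ m
  cross⁺ le = ℚ.toℚᵘ-cancel-≤ (ℚᵘ.≤-respʳ-≃ (ℚᵘ.≃-sym (ℚ.toℚᵘ-fromℚᵘ (mkℚᵘ (pos a) b))) (*≤* le))

  q≃ : ↥ q ℤ.* ↧ s ≡ (↥ s ℤ.* pos m) ℤ.* ↧ q
  q≃ = cross-multiply q s m (ℚᵘ.≃-trans (ℚ.toℚᵘ-homo-* s (pos m ℚ./ 1))
         (ℚᵘ.*-congˡ {toℚᵘ s} (ℚ.toℚᵘ-fromℚᵘ (mkℚᵘ (pos m) 0))))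

  to : ↥ s ℤ.* pos m ℤ.≤ pos a ℤ.* ↧ s → ↥ q ℤ.≤ pos a ℤ.* ↧ q
  to le = ℤ.*-cancelʳ-≤-pos (↥ q) (pos a ℤ.* ↧ q) (↧ s) (begin
    ↥ q ℤ.* ↧ s               ≡⟨ q≃ ⟩
    (↥ s ℤ.* pos m) ℤ.* ↧ q     ≤⟨ ℤ.*-monoʳ-≤-nonNeg (↧ q) le ⟩
    (pos a ℤ.* ↧ s) ℤ.* ↧ q     ≡⟨ swap (pos a) (↧ s) (↧ q) ⟩
    (pos a ℤ.* ↧ q) ℤ.* ↧ s     ∎)

  from : ↥ q ℤ.≤ pos a ℤ.* ↧ q → ↥ s ℤ.* pos m ℤ.≤ pos a ℤ.* ↧ s
  from le = ℤ.*-cancelʳ-≤-pos (↥ s ℤ.* pos m) (pos a ℤ.* ↧ s) (↧ q) (begin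
    (↥ s ℤ.* pos m) ℤ.* ↧ q     ≡⟨ q≃ ⟨
    ↥ q ℤ.* ↧ s               ≤⟨ ℤ.*-monoʳ-≤-nonNeg (↧ s) le ⟩
    (pos a ℤ.* ↧ q) ℤ.* ↧ s     ≡⟨ swap (pos a) (↧ q) (↧ s) ⟩
    (pos a ℤ.* ↧ s) ℤ.* ↧ q     ∎)

-- Rules and common columns.

module Mining {n : ℕ} (I : AttributeSet n) (boolean : ∀ j → Boolean (I j)) (T : Database I)
              (rest : List Bool) (k p : ℕ) (1≤p : 1 ≤ p) where

  m : ℕ
  m = length T

  M : ℕ → ℕ → Bool
  M = entryAt (concatMap (row I) T ++ rest) m n k

  M-lookup : ∀ i j → M (toℕ i) (toℕ j) ≡ is-just (List.lookup T i j)
  M-lookup = nth-row I T rest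

  Supported : Rule I → Set
  Supported R = ¬ Trivial R T × k ≤ Rule.size R × p ≤ length (select (Rule.body∧head R) T)

  satisfiesAtom : ∀ (C : AtomicCondition I) t t′ → SatisfiesAtom C t →
    is-just (t′ (proj₁ C)) ≡ true → SatisfiesAtom C t′
  satisfiesAtom (j , r) t t′ s = is-just⇒Any (fulfils-all (I j) (boolean j) (proj₂ (Maybe.satisfied s)))

  module _ (R : Rule I) (supported : Supported R) where
    open Rule R
    private
      nontrivial = proj₁ supported
      k≤size     = proj₁ (proj₂ supported)
      p≤support  = proj₂ (proj₂ supported)

      good : ℕ → Bool
      good = holdsAt (satisfies? body∧head) T

      p≤count : p ≤ count good m
      p≤count = subst (p ≤_) (sym (count-holdsAt (satisfies? body∧head) T)) p≤support

    -- As `1 ≤ p`, some tuple satisfies `C`, so every non-null value fulfils its relation. Were the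
    -- column constantly 1, all tuples would satisfy `C` and the rule would be trivial.
    common-attribute : ∀ {js} → All (λ i → good i ≡ true) js →
      ∀ {j} → j ∈ attributesOf body∧head → common M m n k js (toℕ j) ≡ true
    common-attribute {js} goods {j} j∈ with ∈-map⁻ proj₁ j∈
    ... | C , C∈ , refl = common⁺ M m n k (All.map entries goods) ¬all
      where
      entries : ∀ {i} → good i ≡ true → M i (toℕ (proj₁ C)) ≡ true
      entries {i} g with holdsAt⁻ (satisfies? body∧head) T i g
      ... | i′ , refl , sat = trans (M-lookup i′ (proj₁ C)) (Any⇒is-just (All.lookup sat C∈))
      some : ∃[ t ] SatisfiesAtom C t
      some with count-suc⁻ m (ℕ.≤-trans 1≤p p≤count)
      ... | i , _ , g , _ with holdsAt⁻ (satisfies? body∧head) T i g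
      ... | i′ , _ , sat = List.lookup T i′ , All.lookup sat C∈
      ¬all : ¬ (∀ i → i < m → M i (toℕ (proj₁ C)) ≡ true)
      ¬all all = nontrivial (lose C∈ (List.filter-all (satisfies? [ C ]) (All.tabulate every)))
        where
        every : ∀ {t} → t ∈ T → Satisfies [ C ] t
        every {t} t∈ = satisfiesAtom C (proj₁ some) t (proj₂ some) (trans
          (cong (λ u → is-just (u (proj₁ C))) (Any.lookup-index t∈))
          (trans (sym (M-lookup (Any.index t∈) (proj₁ C))) (all _ (Fin.toℕ<n (Any.index t∈))))) ∷ []

    -- Any `p` of the supporting rows will do. The attributes of the rule are distinct common
    -- columns, and body and head contribute at least one each.
    rule⇒search : search M m n k p m [] ≡ true
    rule⇒search with count⇒Descending p m {[]} p≤count []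
    ... | js , js↓ , goods = search⁺ M m n k js↓ (ℕ.≤-trans k≤size size≤) (ℕ.≤-trans 2≤size size≤)
      where
      unique : Unique (attributesOf body∧head)
      unique = subst Unique (sym (List.map-++ proj₁ (Condition.conjuncts body) _))
        (Unique.++⁺ (Condition.distinct body) (Condition.distinct head) disjoint)
      size≤ : size ≤ count (common M m n k js) n
      size≤ = subst (_≤ count (common M m n k js) n)
        (trans (List.length-map proj₁ body∧head) (List.length-++ (Condition.conjuncts body)))
        (Unique⇒≤count (common M m n k js) unique (All.tabulate (common-attribute goods)))
      nonempty : ∀ {A B : Set} {f : A → B} (xs : List A) → ¬ (map f xs ≡ []) → 1 ≤ length xs
      nonempty []      ne = ⊥-elim (ne refl)
      nonempty (_ ∷ _) ne = s≤s z≤n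
      2≤size : 2 ≤ size
      2≤size = ℕ.+-mono-≤ (nonempty (Condition.conjuncts body) body-nonempty)
                          (nonempty (Condition.conjuncts head) head-nonempty)

  nonNullAtom : Fin n → AtomicCondition I
  nonNullAtom j = j , nonNull (I j) (boolean j)

  attributesOf-nonNull : ∀ js → attributesOf {I = I} (map nonNullAtom js) ≡ js
  attributesOf-nonNull js = trans (sym (List.map-∘ js)) (List.map-id js)

  -- All common columns enter the rule: the first is the body and the others form the head, nonempty
  -- because there are at least two.
  search⇒rule : search M m n k p m [] ≡ true → ∃[ R ] Supported R
  search⇒rule t with search⁻ M m n k p t
  ... | js , js↓ , k≤ , 2≤ = build columns refl (subst (2 ≤_) (sym #columns) 2≤) (subst (k ≤_) (sym #columns) k≤)
    where
    columns : List (Fin n)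
    columns = goodFins (common M m n k js)
    #columns = length-goodFins {n} (common M m n k js)

    isCommon : ∀ {j} → j ∈ columns → common M m n k js (toℕ j) ≡ true
    isCommon j∈ = proj₂ (∈-filter⁻ (λ (j : Fin n) → common M m n k js (toℕ j) Bool.≟ true) {xs = allFin n} j∈)

    unique : Unique columns
    unique = Unique.filter⁺ (λ j → common M m n k js (toℕ j) Bool.≟ true) (Unique.allFin⁺ n)

    js< : All (_< m) js
    js< = Descending-< js↓ ℕ.≤-refl []

    -- A variable equal to `columns` is used because the filtered list itself cannot be matched on.
    build : ∀ cs → cs ≡ columns → 2 ≤ length cs → k ≤ length cs → ∃[ R ] Supported R
    build (_ ∷ []) _ (s≤s ()) _
    build cs@(c ∷ cs′@(_ ∷ _)) cs≡ _ k≤ = R , nontrivial ,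
      subst (k ≤_) (cong suc (sym (List.length-map nonNullAtom cs′))) k≤ ,
      subst (p ≤_) (count-holdsAt (satisfies? (map nonNullAtom cs)) T)
        (proj₁ (Descending⇒count js↓ (All.tabulate (λ i∈ → supports (All.lookup js< i∈) i∈))))
      where
      uniqueᶜ : Unique cs
      uniqueᶜ = subst Unique (sym cs≡) unique
      isCommonᶜ : ∀ {j} → j ∈ cs → common M m n k js (toℕ j) ≡ true
      isCommonᶜ {j} j∈ = isCommon (subst (j ∈_) cs≡ j∈)

      R : Rule I
      R = record
        { body = record { conjuncts = [ nonNullAtom c ] ; distinct = [] ∷ [] }
        ; head = record { conjuncts = map nonNullAtom cs′
                        ; distinct  = subst Unique (sym (attributesOf-nonNull cs′)) (case uniqueᶜ of λ { (_ ∷ u) → u }) }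
        ; body-nonempty = λ ()
        ; head-nonempty = λ ()
        ; disjoint = λ { (here refl , c∈) → case uniqueᶜ of λ { (c∉ ∷ _) →
            All.lookup c∉ (subst (c ∈_) (attributesOf-nonNull cs′) c∈) refl } } }

      nontrivial : ¬ Trivial R T
      nontrivial triv with find triv
      ... | C , C∈ , eq with ∈-map⁻ nonNullAtom {xs = cs} C∈
      ... | j , j∈ , refl = proj₂ (common⁻ M m n k js (isCommonᶜ j∈)) (λ i i< →
        subst (λ i → M i (toℕ j) ≡ true) (Fin.toℕ-fromℕ< i<)
          (trans (M-lookup (Fin.fromℕ< i<) j) (Any⇒is-just (All.head
            (All.lookup (filter-≡⁻ (satisfies? [ nonNullAtom j ]) T eq) (∈-lookup (Fin.fromℕ< i<)))))))

      supports : ∀ {i} → i < m → i ∈ js → holdsAt (satisfies? (map nonNullAtom cs)) T i ≡ true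
      supports {i} i< i∈ = subst (λ i → holdsAt (satisfies? (map nonNullAtom cs)) T i ≡ true) (Fin.toℕ-fromℕ< i<)
        (trans (holdsAt-lookup (satisfies? (map nonNullAtom cs)) T (Fin.fromℕ< i<))
          (dec-true (satisfies? (map nonNullAtom cs) _) (All.map⁺ (All.tabulate λ {j} j∈ →
            is-just⇒Any (fulfils-nonNull (I j) (boolean j)) (trans (sym (M-lookup (Fin.fromℕ< i<) j))
              (subst (λ i → M i (toℕ j) ≡ true) (sym (Fin.toℕ-fromℕ< i<))
                (All.lookup (proj₁ (common⁻ M m n k js (isCommonᶜ j∈))) i∈)))))))

-- From formulas to the class TC⁰.

problemFormula-⇔ : ∀ body m n k p {v} → v ≡ unary m ++ unary n ++ unary k ++ body →
  ⟦ problemFormula p ⟧ v (length v ∷ []) ≡ true ⇔ search (entryAt body m n k) m n k p m [] ≡ true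
problemFormula-⇔ body m n k p refl = decode-⇔ body m n k p

-- Gives a name to the bits after the matrix, so that the results on the matrix apply with an
-- arbitrary tail.
encode-split : ∀ {p} (x : BooleanInstance p) → let open BooleanInstance x in
  ∃[ tail ] encode x ≡ unary (length T) ++ unary #attributes ++ unary k ++ concatMap (row I) T ++ tail
encode-split x = _ , refl

formula-InTC⁰ : ∀ {a ℓ} {X : Set a} (φ : Formula 1) (enc : X → List Bool) {Q : X → Set ℓ} →
  (∀ x → Q x ⇔ ⟦ φ ⟧ (enc x) (length (enc x) ∷ []) ≡ true) → InTC⁰ enc Q
formula-InTC⁰ φ enc Q⇔ = family , constantDepth , polynomialSize , logspaceUniform , λ x → mk⇔
  (λ q → trans (accepts-⟦⟧ (enc x)) (Equivalence.to (Q⇔ x) q))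
  (λ t → Equivalence.from (Q⇔ x) (trans (sym (accepts-⟦⟧ (enc x))) t))
  where open Family φ

theorem6p3 : (p : ℕ) → 1 ≤ p →
    InTC⁰ {X = BooleanInstance p} encode (λ x → Solvable sup (BooleanInstance.inst x))
theorem6p3 p 1≤p = formula-InTC⁰ (problemFormula p) encode correct
  where
  correct : (x : BooleanInstance p) →
    Solvable sup (BooleanInstance.inst x) ⇔ ⟦ problemFormula p ⟧ (encode x) (length (encode x) ∷ []) ≡ true
  correct x = mk⇔
    (λ { (R , nontrivial , k≤ , s≤) → Equivalence.from decode
      (rule⇒search R (nontrivial , k≤ , Equivalence.to (threshold⇔ R) s≤)) })
    (λ t → case search⇒rule (Equivalence.to decode t) of λ { (R , nontrivial , k≤ , p≤) →
      R , nontrivial , k≤ , Equivalence.from (threshold⇔ R) p≤ })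
    where
    open BooleanInstance x
    tail = proj₁ (encode-split x)
    open Mining I boolean T tail k p 1≤p
    threshold⇔ : (R : Rule I) → s ℚ.≤ sup R T ⇔ p ≤ length (select (Rule.body∧head R) T)
    threshold⇔ R = ratio-≥-⇔ {s} {length (select (Rule.body∧head R) T)} {length T} threshold 1≤p
    decode : ⟦ problemFormula p ⟧ (encode x) (length (encode x) ∷ []) ≡ true ⇔ search M m #attributes k p m [] ≡ true
    decode = problemFormula-⇔ (concatMap (row I) T ++ tail) m #attributes k p (proj₂ (encode-split x))
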